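{- Let $M$ be a matroid. (i) Each MI-orderable antichain $\mathcal{A}$ in $\mathcal{Z}(M)$ satisfies the inequality $$r\Bigl(\bigcap_{X\in\mathcal{A}}X\Bigr)\le \sum_{\emptyset\neq\mathcal{F}\subseteq\mathcal{A}}(-1)^{|\mathcal{F}|+1}\, r\Bigl(\bigcup_{X\in\mathcal{F}}X\Bigr).$$ (ii) If $\mathcal{Z}(M)$ is an MI-lattice, then $M$ and all of its minors are transversal.
   Context: All matroids are finite; $r$ denotes the rank function of $M$. A flat $X$ of $M$ is cyclic if $M|X$ has no isthmuses. The cyclic flats ordered by inclusion form a lattice $\mathcal{Z}(M)$, with $A\lor B=\mathrm{cl}(A\cup B)$ and $A\land B$ the union of the circuits contained in $A\cap B$. An MI-ordering of an antichain $\mathcal{A}$ in a lattice $L$ is a listing $a_1,a_2,\ldots,a_t$ of the elements of $\mathcal{A}$ (each exactly once) such that (i) $a_i\lor a_{i+1}\lor\cdots\lor a_k=a_i\lor a_k$ for all $1\le i<k\le t$, and (ii) $(a_1\land a_2\land\cdots\land a_k)\lor a_{k+1}=a_k\lor a_{k+1}$ for all $1<k<t$. An antichain is MI-orderable if it has an MI-ordering; a lattice is an MI-lattice (MI-orderable) if each of its antichains is MI-orderable. -}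

module Defs where

open import Data.Nat using (ℕ; zero; suc; _≤_; _<_; _∸_; _+_; _<?_)
open import Data.Nat.Properties using (_≟_)
open import Data.Integer as ℤ using (ℤ)
open import Data.Bool using (Bool; true; false)
open import Data.Fin using (Fin)
open import Data.Fin.Subset using (Subset; _∈_; _∉_; _⊆_; _⊂_; _∪_; _∩_; ∁; ⁅_⁆; _-_; ∣_∣; ⊥; ⊤)
open import Data.Fin.Subset.Properties using (_∈?_; _⊆?_; _⊂?_; anySubset?)
open import Data.List using (List; []; _∷_; foldr; length; take; drop; map; _++_)
open import Data.List.Relation.Unary.All using (All)
open import Data.List.Relation.Unary.AllPairs using (AllPairs)
open import Data.List.Relation.Binary.Permutation.Propositional using (_↭_)
open import Data.Vec using (tabulate)
open import Data.Product using (Σ; ∃; _×_; _,_)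
open import Relation.Nullary using (¬_; Dec; yes; no)
open import Relation.Nullary.Decidable using (⌊_⌋; _×-dec_; ¬?)
open import Relation.Binary.PropositionalEquality using (_≡_; _≢_)
open import Function.Bundles using (_⇔_)

record Matroid (n : ℕ) : Set where
  field
    r        : Subset n → ℕ
    r-bound  : ∀ X → r X ≤ ∣ X ∣
    r-mono   : ∀ X Y → X ⊆ Y → r X ≤ r Y
    r-submod : ∀ X Y → r (X ∪ Y) + r (X ∩ Y) ≤ r X + r Y

module _ {n : ℕ} (M : Matroid n) where
  open Matroid M

  cl : Subset n → Subset n
  cl X = tabulate (λ e → ⌊ r (X ∪ ⁅ e ⁆) ≟ r X ⌋)

  IsFlat : Subset n → Set
  IsFlat X = cl X ≡ X

  IsIsthmusOf : Subset n → Fin n → Set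
  IsIsthmusOf X e = e ∈ X × r (X - e) < r X

  IsCyclic : Subset n → Set
  IsCyclic X = ∀ e → ¬ IsIsthmusOf X e

  IsCyclicFlat : Subset n → Set
  IsCyclicFlat X = IsFlat X × IsCyclic X

  Independent : Subset n → Set
  Independent X = r X ≡ ∣ X ∣

  IsCircuit : Subset n → Set
  IsCircuit C = ¬ Independent C × ¬ (∃ λ X → X ⊂ C × ¬ Independent X)

  circuit? : ∀ C → Dec (IsCircuit C)
  circuit? C = ¬? (r C ≟ ∣ C ∣)
         ×-dec ¬? (anySubset? (λ X → (X ⊂? C) ×-dec ¬? (r X ≟ ∣ X ∣)))

  _∨ᶻ_ : Subset n → Subset n → Subset n
  A ∨ᶻ B = cl (A ∪ B)

  _∧ᶻ_ : Subset n → Subset n → Subset n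
  A ∧ᶻ B = tabulate (λ e → ⌊ anySubset?
             (λ C → (C ⊆? (A ∩ B)) ×-dec (circuit? C ×-dec (e ∈? C))) ⌋)

  joinList : List (Subset n) → Subset n
  joinList []           = cl ⊥
  joinList (x ∷ [])     = x
  joinList (x ∷ y ∷ ys) = x ∨ᶻ joinList (y ∷ ys)

  meetList : List (Subset n) → Subset n
  meetList []       = ⊤
  meetList (x ∷ xs) = go x xs
    where
    go : Subset n → List (Subset n) → Subset n
    go acc []       = acc
    go acc (y ∷ ys) = go (acc ∧ᶻ y) ys

  -- ℕ-indexed lookup (default only used out of range)
  at : List (Subset n) → ℕ → Subset n
  at []       _       = ⊥
  at (x ∷ xs) zero    = x
  at (x ∷ xs) (suc i) = at xs i

  -- An antichain of Z(M), given as a duplicate-free list of cyclic flats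
  -- that are pairwise incomparable.
  IsAntichain : List (Subset n) → Set
  IsAntichain As = All IsCyclicFlat As
                 × AllPairs (λ X Y → ¬ X ⊆ Y × ¬ Y ⊆ X) As

  -- MI-ordering a₁,…,a_t stored 0-based in a list L (a_j = at L (j-1)).
  IsMIOrdering : List (Subset n) → Set
  IsMIOrdering L =
      (∀ i k → i < k → k < length L →
         joinList (take (suc k ∸ i) (drop i L)) ≡ at L i ∨ᶻ at L k)
    × (∀ k → 1 < k → k < length L →
         meetList (take k L) ∨ᶻ at L k ≡ at L (k ∸ 1) ∨ᶻ at L k)

  MIOrderable : List (Subset n) → Set
  MIOrderable As = ∃ λ L → (L ↭ As) × IsMIOrdering L

  IsMILattice : Set
  IsMILattice = ∀ As → IsAntichain As → MIOrderable As

  sublists : List (Subset n) → List (List (Subset n))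
  sublists []       = [] ∷ []
  sublists (x ∷ xs) = map (x ∷_) (sublists xs) ++ sublists xs

  sgn : ℕ → ℤ
  sgn zero          = ℤ.-1ℤ
  sgn (suc zero)    = ℤ.1ℤ
  sgn (suc (suc k)) = sgn k

  signedTerm : List (Subset n) → ℤ
  signedTerm []       = ℤ.0ℤ
  signedTerm F@(_ ∷ _) = sgn (length F) ℤ.* ℤ.+ r (foldr _∪_ ⊥ F)

  incExc : List (Subset n) → ℤ
  incExc As = foldr (λ F s → signedTerm F ℤ.+ s) ℤ.0ℤ (sublists As)

IsPartialTransversal : ∀ {n k} → (Fin k → Subset n) → Subset n → Set
IsPartialTransversal {n} {k} A X =
  Σ (Fin n → Fin k) λ f →
      (∀ x → x ∈ X → x ∈ A (f x))
    × (∀ x y → x ∈ X → y ∈ X → f x ≡ f y → x ≡ y)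

IsTransversal : ∀ {n} → (E : Subset n) → (Subset n → ℕ) → Set
IsTransversal {n} E ρ =
  Σ ℕ λ k → Σ (Fin k → Subset n) λ A →
      (∀ i → A i ⊆ E)
    × (∀ X → X ⊆ E → (ρ X ≡ ∣ X ∣) ⇔ IsPartialTransversal A X)

-- the minor M / C \ D (C, D disjoint): ground set E − (C ∪ D),
-- rank X ↦ r(X ∪ C) − r(C)
minorGround : ∀ {n} → Subset n → Subset n → Subset n
minorGround C D = ∁ (C ∪ D)

minorRank : ∀ {n} → Matroid n → Subset n → Subset n → ℕ
minorRank M C X = Matroid.r M (X ∪ C) ∸ Matroid.r M C

Disjoint : ∀ {n} → Subset n → Subset n → Set
Disjoint C D = C ∩ D ≡ ⊥

{-# OPTIONS --safe #-}

-- (i) In an MI-ordering a₁, …, aₜ, the join condition makes the alternating sum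
-- collapse to Σ r(aᵢ) − Σ r(aᵢ ∪ aᵢ₊₁). By submodularity the rank of the
-- intersection is at most this: the meet condition gives
-- r((a₁ ∩ ⋯ ∩ aₖ) ∪ aₖ₊₁) ≥ r(aₖ ∪ aₖ₊₁).
--
-- (ii) Regard N = M/C as a matroid in which the elements of C are loops. A cyclic
-- flat b of N is a ∪ C, where a is the cyclic flat of M formed by the circuits in
-- b, so an MI-ordering of the a's yields the inequality above for the b's.
-- Following Mason and Ingleton, choose, from the largest cyclic flats of N down, a
-- multiset P of cyclic flats such that each cyclic flat F is contained in exactly
-- r(N) − r(F) members of P. This is possible, and every set X is contained in at
-- most r(N) − r(X) members: list the minimal members of P properly containing X in
-- an MI-ordering, and note that a member of P containing s ≥ 1 terms of the list
-- contains at most s − 1 consecutive pairs. Hall's theorem then shows that the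
-- complements of the members of P present N. Deletions only intersect the
-- presenting sets with the remaining ground set.
module Submission where

open import Defs
open import Data.Nat as ℕ using (ℕ; zero; suc; z≤n; s≤s; _∸_)
import Data.Nat.Properties as ℕₚ
open import Algebra.Properties.CommutativeSemigroup ℕₚ.+-commutativeSemigroup using () renaming (interchange to ℕ-interchange)
open import Data.Nat.Tactic.RingSolver using (solve-∀)
open import Data.Integer as ℤ using (ℤ; _≤_; +_)
import Data.Integer.Properties as ℤₚ
open import Algebra.Properties.CommutativeSemigroup ℤₚ.+-commutativeSemigroup using () renaming (interchange to ℤ-interchange)
open import Data.Integer.Tactic.RingSolver using () renaming (solve-∀ to ℤ-solve-∀)
import Data.Bool.Properties as Bool
open import Data.Empty using (⊥-elim) renaming (⊥ to ⊥₀)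
open import Data.Fin as Fin using (Fin; zero; suc)
import Data.Fin.Properties as Finₚ
open import Data.Fin.Subset using (Subset; inside; outside; _∈_; _∉_; _⊆_; _⊂_; _∪_; _∩_; ∁; ⁅_⁆; _─_; _-_; ∣_∣; ⊥; ⊤)
open import Data.Fin.Subset.Properties
open import Data.Fin.Subset.Induction using (⊂-wellFounded; Acc; acc)
open import Data.List using (List; []; _∷_; _∷ʳ_; _++_; foldr; length; lookup; map; filter; replicate; take; drop)
open import Data.List.Properties using (length-++)
open import Data.List.Membership.Propositional using (find; lose) renaming (_∈_ to _∈ˡ_)
open import Data.List.Membership.Propositional.Properties using (∈-++⁺ˡ; ∈-++⁺ʳ; ∈-++⁻; ∈-map⁺; ∈-map⁻; ∈-filter⁺; ∈-filter⁻)
open import Data.List.Relation.Binary.Permutation.Propositional using (_↭_; prep; swap; ↭-sym)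
open import Data.List.Relation.Binary.Permutation.Propositional.Properties using (∈-resp-↭; ↭-empty-inv)
open import Data.List.Relation.Unary.Any using (Any; here; there; any?)
open import Data.List.Relation.Unary.All as All using (All; []; _∷_)
import Data.List.Relation.Unary.All.Properties as All
open import Data.List.Relation.Unary.AllPairs as AllPairsᵇ using (AllPairs; []; _∷_)
import Data.List.Relation.Unary.AllPairs.Properties as AllPairs
open import Data.Product using (∃; _×_; _,_; proj₁; proj₂)
open import Data.Sum using (_⊎_; inj₁; inj₂; [_,_]′)
open import Data.Unit using (tt) renaming (⊤ to Unit)
open import Data.Vec as Vec using ([]; _∷_)
open import Data.Vec.Properties using (lookup∘tabulate; []=⇒lookup; lookup⇒[]=; ≡-dec)
open import Function using (_∘_; id; _⇔_; mk⇔)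
open import Relation.Nullary using (¬_; Dec; yes; no; contradiction)
open import Relation.Nullary.Decidable using (⌊_⌋; _×-dec_; ¬?; decidable-stable)
open import Relation.Unary using (Decidable)
open import Relation.Binary.PropositionalEquality using (_≡_; _≢_; refl; sym; trans; cong; cong₂; subst; subst₂; module ≡-Reasoning)

private
  variable
    n : ℕ

-- Subsets of a finite set and their sizes

∪-lub : ∀ {A B X : Subset n} → A ⊆ X → B ⊆ X → A ∪ B ⊆ X
∪-lub {A = A} {B} A⊆X B⊆X x∈ = [ A⊆X , B⊆X ]′ (x∈p∪q⁻ A B x∈)

∪-mono : ∀ {A B X Y : Subset n} → A ⊆ X → B ⊆ Y → A ∪ B ⊆ X ∪ Y
∪-mono {X = X} {Y} A⊆X B⊆Y = ∪-lub (λ x∈ → p⊆p∪q Y (A⊆X x∈)) (λ x∈ → q⊆p∪q X Y (B⊆Y x∈))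

∩-glb : ∀ {A B X : Subset n} → X ⊆ A → X ⊆ B → X ⊆ A ∩ B
∩-glb X⊆A X⊆B x∈ = x∈p∩q⁺ (X⊆A x∈ , X⊆B x∈)

⁅⁆⊆ : ∀ {x} {X : Subset n} → x ∈ X → ⁅ x ⁆ ⊆ X
⁅⁆⊆ {x = x} {X} x∈X y∈ = subst (_∈ X) (sym (x∈⁅y⁆⇒x≡y x y∈)) x∈X

∈─⇒∉ : ∀ {x} (A B : Subset n) → x ∈ A ─ B → x ∉ B
∈─⇒∉ (_ ∷ A) (outside ∷ B) (Vec.there x∈) (Vec.there x∈B) = ∈─⇒∉ A B x∈ x∈B
∈─⇒∉ (_ ∷ A) (inside ∷ B) (Vec.there x∈) (Vec.there x∈B) = ∈─⇒∉ A B x∈ x∈B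

x∉X-x : ∀ x (X : Subset n) → x ∉ X - x
x∉X-x x X x∈ = ∈─⇒∉ X ⁅ x ⁆ x∈ (x∈⁅x⁆ x)

-⊆ : ∀ (X : Subset n) x → X - x ⊆ X
-⊆ X x = p─q⊆p X ⁅ x ⁆

⊆- : ∀ {X Y : Subset n} {x} → X ⊆ Y → x ∉ X → X ⊆ Y - x
⊆- {X = X} X⊆Y x∉X y∈X = x∈p∧x≢y⇒x∈p-y (X⊆Y y∈X) (λ y≡x → x∉X (subst (_∈ X) y≡x y∈X))

-mono : ∀ {X Y : Subset n} x → X ⊆ Y → X - x ⊆ Y - x
-mono {X = X} x X⊆Y = ⊆- (λ y∈ → X⊆Y (-⊆ X x y∈)) (x∉X-x x X)

⊆∧≢⇒⊂ : ∀ {X Y : Subset n} → X ⊆ Y → X ≢ Y → X ⊂ Y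
⊆∧≢⇒⊂ {X = X} {Y} X⊆Y X≢Y with Finₚ.any? (λ x → (x ∈? Y) ×-dec ¬? (x ∈? X))
... | yes (x , x∈Y , x∉X) = X⊆Y , x , x∈Y , x∉X
... | no none = contradiction (⊆-antisym X⊆Y Y⊆X) X≢Y
  where
  Y⊆X : Y ⊆ X
  Y⊆X {x} x∈Y with x ∈? X
  ... | yes x∈X = x∈X
  ... | no x∉X = contradiction (x , x∈Y , x∉X) none

∣∪∣+∣∩∣ : ∀ (A B : Subset n) → ∣ A ∪ B ∣ ℕ.+ ∣ A ∩ B ∣ ≡ ∣ A ∣ ℕ.+ ∣ B ∣
∣∪∣+∣∩∣ [] [] = refl
∣∪∣+∣∩∣ (outside ∷ A) (outside ∷ B) = ∣∪∣+∣∩∣ A B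
∣∪∣+∣∩∣ (outside ∷ A) (inside ∷ B) = trans (cong suc (∣∪∣+∣∩∣ A B)) (sym (ℕₚ.+-suc ∣ A ∣ ∣ B ∣))
∣∪∣+∣∩∣ (inside ∷ A) (outside ∷ B) = cong suc (∣∪∣+∣∩∣ A B)
∣∪∣+∣∩∣ (inside ∷ A) (inside ∷ B) =
  cong suc (trans (ℕₚ.+-suc ∣ A ∪ B ∣ ∣ A ∩ B ∣)
    (trans (cong suc (∣∪∣+∣∩∣ A B)) (sym (ℕₚ.+-suc ∣ A ∣ ∣ B ∣))))

∣∣≤1+∣-∣ : ∀ (X : Subset n) x → ∣ X ∣ ℕ.≤ suc ∣ X - x ∣
∣∣≤1+∣-∣ X x = begin
  ∣ X ∣                                    ≤⟨ p⊆q⇒∣p∣≤∣q∣ X⊆ ⟩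
  ∣ (X - x) ∪ ⁅ x ⁆ ∣                      ≤⟨ ℕₚ.m≤m+n _ _ ⟩
  ∣ (X - x) ∪ ⁅ x ⁆ ∣ ℕ.+ ∣ (X - x) ∩ ⁅ x ⁆ ∣ ≡⟨ ∣∪∣+∣∩∣ (X - x) ⁅ x ⁆ ⟩
  ∣ X - x ∣ ℕ.+ ∣ ⁅ x ⁆ ∣                  ≡⟨ cong (∣ X - x ∣ ℕ.+_) (∣⁅x⁆∣≡1 x) ⟩
  ∣ X - x ∣ ℕ.+ 1                          ≡⟨ ℕₚ.+-comm _ 1 ⟩
  suc ∣ X - x ∣ ∎
  where
  open ℕₚ.≤-Reasoning
  X⊆ : X ⊆ (X - x) ∪ ⁅ x ⁆
  X⊆ {y} y∈X with y Fin.≟ x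
  ... | yes refl = x∈p∪q⁺ (inj₂ (x∈⁅x⁆ y))
  ... | no y≢x = x∈p∪q⁺ (inj₁ (x∈p∧x≢y⇒x∈p-y y∈X y≢x))

∣∣+∣─∣≤ : ∀ {A B : Subset n} → A ⊆ B → ∣ A ∣ ℕ.+ ∣ B ─ A ∣ ℕ.≤ ∣ B ∣
∣∣+∣─∣≤ {n} {A} {B} A⊆B = begin
  ∣ A ∣ ℕ.+ ∣ B ─ A ∣                   ≡⟨ ∣∪∣+∣∩∣ A (B ─ A) ⟨
  ∣ A ∪ (B ─ A) ∣ ℕ.+ ∣ A ∩ (B ─ A) ∣   ≤⟨ ℕₚ.+-mono-≤ (p⊆q⇒∣p∣≤∣q∣ (∪-lub A⊆B (p─q⊆p B A))) (p⊆q⇒∣p∣≤∣q∣ ∩⊆⊥) ⟩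
  ∣ B ∣ ℕ.+ ∣ ⊥ {n} ∣                   ≡⟨ cong (∣ B ∣ ℕ.+_) (∣⊥∣≡0 n) ⟩
  ∣ B ∣ ℕ.+ 0                           ≡⟨ ℕₚ.+-identityʳ _ ⟩
  ∣ B ∣ ∎
  where
  open ℕₚ.≤-Reasoning
  ∩⊆⊥ : A ∩ (B ─ A) ⊆ ⊥
  ∩⊆⊥ x∈ = let x∈A , x∈B─A = x∈p∩q⁻ A (B ─ A) x∈ in contradiction x∈A (∈─⇒∉ B A x∈B─A)

minimal-subset : ∀ {P : Subset n → Set} → Decidable P → ∀ X → P X →
  ∃ λ Y → Y ⊆ X × P Y × (∀ Z → Z ⊂ Y → ¬ P Z)
minimal-subset {P = P} P? X = go X (⊂-wellFounded X)
  where
  go : ∀ X → Acc _⊂_ X → P X → ∃ λ Y → Y ⊆ X × P Y × (∀ Z → Z ⊂ Y → ¬ P Z)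
  go X (acc rec) pX with anySubset? (λ Z → (Z ⊂? X) ×-dec P? Z)
  ... | no none = X , id , pX , λ Z Z⊂X pZ → none (Z , Z⊂X , pZ)
  ... | yes (Z , Z⊂X , pZ) with go Z (rec Z⊂X) pZ
  ...   | Y , Y⊆Z , pY , min = Y , (λ y∈ → proj₁ Z⊂X (Y⊆Z y∈)) , pY , min

ℤ-+-cancelʳ-≤ : ∀ k {i j} → i ℤ.+ k ≤ j ℤ.+ k → i ≤ j
ℤ-+-cancelʳ-≤ k {i} {j} le = subst₂ _≤_ (cancel i k) (cancel j k) (ℤₚ.+-monoˡ-≤ (ℤ.- k) le)
  where
  cancel : ∀ i k → (i ℤ.+ k) ℤ.+ ℤ.- k ≡ i
  cancel = ℤ-solve-∀

-- Counting

indicator : ∀ {A : Set} → Dec A → ℕ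
indicator (yes _) = 1
indicator (no _) = 0

indicator≤1 : ∀ {A : Set} (d : Dec A) → indicator d ℕ.≤ 1
indicator≤1 (yes _) = s≤s z≤n
indicator≤1 (no _) = z≤n

module _ {A : Set} where

  count : ∀ {P : A → Set} → Decidable P → List A → ℕ
  count P? [] = 0
  count P? (x ∷ xs) = indicator (P? x) ℕ.+ count P? xs

  count-mono : ∀ {P Q : A → Set} (P? : Decidable P) (Q? : Decidable Q) xs →
    (∀ {x} → x ∈ˡ xs → P x → Q x) → count P? xs ℕ.≤ count Q? xs
  count-mono P? Q? [] P⇒Q = z≤n
  count-mono P? Q? (x ∷ xs) P⇒Q = ℕₚ.+-mono-≤ (pointwise (P? x) (Q? x)) (count-mono P? Q? xs (P⇒Q ∘ there))
    where
    pointwise : ∀ p q → indicator p ℕ.≤ indicator q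
    pointwise (no _) _ = z≤n
    pointwise (yes _) (yes _) = s≤s z≤n
    pointwise (yes p) (no ¬q) = contradiction (P⇒Q (here refl) p) ¬q

  -- Holds entry by entry, by cases on which of the four predicates hold. It gives the
  -- supermodularity of `#⊇` and the exchange step in `chain-count`.
  count-exchange : ∀ {P Q S T : A → Set} (P? : Decidable P) (Q? : Decidable Q) (S? : Decidable S) (T? : Decidable T) →
    (∀ x → P x → S x ⊎ T x) → (∀ x → Q x → S x ⊎ T x) → (∀ x → P x → Q x → S x × T x) →
    ∀ xs → count P? xs ℕ.+ count Q? xs ℕ.≤ count S? xs ℕ.+ count T? xs
  count-exchange P? Q? S? T? P⇒ Q⇒ PQ⇒ [] = z≤n
  count-exchange P? Q? S? T? P⇒ Q⇒ PQ⇒ (x ∷ xs) = begin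
    (indicator (P? x) ℕ.+ count P? xs) ℕ.+ (indicator (Q? x) ℕ.+ count Q? xs)
      ≡⟨ ℕ-interchange (indicator (P? x)) _ _ _ ⟩
    (indicator (P? x) ℕ.+ indicator (Q? x)) ℕ.+ (count P? xs ℕ.+ count Q? xs)
      ≤⟨ ℕₚ.+-mono-≤ (pointwise (P? x) (Q? x) (S? x) (T? x)) (count-exchange P? Q? S? T? P⇒ Q⇒ PQ⇒ xs) ⟩
    (indicator (S? x) ℕ.+ indicator (T? x)) ℕ.+ (count S? xs ℕ.+ count T? xs)
      ≡⟨ ℕ-interchange (indicator (S? x)) _ _ _ ⟩
    (indicator (S? x) ℕ.+ count S? xs) ℕ.+ (indicator (T? x) ℕ.+ count T? xs) ∎
    where
    open ℕₚ.≤-Reasoning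
    pointwise : ∀ p q s t → indicator p ℕ.+ indicator q ℕ.≤ indicator s ℕ.+ indicator t
    pointwise (no _) (no _) _ _ = z≤n
    pointwise _ (yes _) (yes _) (yes _) = ℕₚ.+-monoˡ-≤ 1 (indicator≤1 _)
    pointwise (yes _) (no _) (yes _) _ = s≤s z≤n
    pointwise (yes _) (no _) (no _) (yes _) = s≤s z≤n
    pointwise (no _) (yes _) (yes _) _ = s≤s z≤n
    pointwise (no _) (yes _) (no _) (yes _) = s≤s z≤n
    pointwise (yes p) _ (no ¬s) (no ¬t) = contradiction (P⇒ x p) [ ¬s , ¬t ]′
    pointwise _ (yes q) (no ¬s) (no ¬t) = contradiction (Q⇒ x q) [ ¬s , ¬t ]′
    pointwise (yes p) (yes q) (no ¬s) _ = contradiction (proj₁ (PQ⇒ x p q)) ¬s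
    pointwise (yes p) (yes q) _ (no ¬t) = contradiction (proj₂ (PQ⇒ x p q)) ¬t

#⊇ : Subset n → List (Subset n) → ℕ
#⊇ X = count (X ⊆?_)

-- Hall's theorem

-- A member of P contains J exactly when its complement misses J, so this is Hall's condition for
-- the complements: at least |J| of them meet J.
Hall : List (Subset n) → Subset n → Set
Hall P X = ∀ J → J ⊆ X → ∣ J ∣ ℕ.+ #⊇ J P ℕ.≤ length P

-- The extra member ⊤ has empty complement; it only supplies a value of the
-- matching at elements outside X.
complements : (P : List (Subset n)) → Fin (length (P ∷ʳ ⊤)) → Subset n
complements P i = ∁ (lookup (P ∷ʳ ⊤) i)

-- Induction on P. If the condition survives without Y, the complement of Y is left unmatched.
-- Otherwise some set is deficient for P; deficient sets are closed under intersection, so a minimal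
-- one J₀ lies in all of them. Matching a point z of J₀ outside Y to the complement of Y leaves no
-- deficient subset of X - z.
Hall⇒transversal : ∀ (P : List (Subset n)) X → Hall P X → IsPartialTransversal (complements P) X
Hall⇒transversal [] X hall = (λ _ → zero) , (λ x x∈X → contradiction x∈X (empty x)) , (λ x _ x∈X _ _ → contradiction x∈X (empty x))
  where
  empty : ∀ x → x ∉ X
  empty x x∈X = contradiction
    (ℕₚ.≤-trans (ℕₚ.≤-reflexive (sym (∣⁅x⁆∣≡1 x))) (ℕₚ.≤-trans (ℕₚ.m≤m+n _ 0) (hall ⁅ x ⁆ (⁅⁆⊆ x∈X)))) λ ()
Hall⇒transversal (Y ∷ P) X hall with anySubset? (λ J → (J ⊆? X) ×-dec (length P ℕ.<? ∣ J ∣ ℕ.+ #⊇ J P))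
... | no none = let f , f∈ , f-inj = Hall⇒transversal P X (λ J J⊆X → ℕₚ.≮⇒≥ (λ < → none (J , J⊆X , <)))
                in suc ∘ f , f∈ , λ x y x∈ y∈ eq → f-inj x y x∈ y∈ (Finₚ.suc-injective eq)
... | yes (J₁ , J₁⊆X , J₁-def)
  with minimal-subset (λ J → (J ⊆? X) ×-dec (length P ℕ.<? ∣ J ∣ ℕ.+ #⊇ J P)) J₁ (J₁⊆X , J₁-def)
... | J₀ , _ , (J₀⊆X , J₀-def) , J₀-min = extend (Finₚ.any? (λ x → (x ∈? J₀) ×-dec ¬? (x ∈? Y)))
  where
  Deficient : Subset _ → Set
  Deficient J = J ⊆ X × length P ℕ.< ∣ J ∣ ℕ.+ #⊇ J P

  -- If J lay in Y, then Y itself would be counted for J, and the condition for Y ∷ P would rule out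
  -- the deficiency.
  deficient⊈Y : ∀ J → Deficient J → ¬ (J ⊆ Y)
  deficient⊈Y J (J⊆X , J-def) J⊆Y with J ⊆? Y | hall J J⊆X
  ... | yes _ | h = ℕₚ.<⇒≱ J-def (ℕₚ.≤-pred (ℕₚ.≤-trans (ℕₚ.≤-reflexive (sym (ℕₚ.+-suc ∣ J ∣ _))) h))
  ... | no J⊈Y | h = J⊈Y J⊆Y

  -- |·| is modular and #⊇ is supermodular, while Hall bounds the union by |P| + 1.
  deficient-∩ : ∀ J K → Deficient J → Deficient K → Deficient (J ∩ K)
  deficient-∩ J K (J⊆X , J-def) (K⊆X , K-def) =
    (λ x∈ → J⊆X (p∩q⊆p J K x∈)) , ℕₚ.+-cancelˡ-≤ (suc (length P)) _ _ (begin
      suc (length P) ℕ.+ suc (length P)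
        ≤⟨ ℕₚ.+-mono-≤ J-def K-def ⟩
      (∣ J ∣ ℕ.+ #⊇ J P) ℕ.+ (∣ K ∣ ℕ.+ #⊇ K P)
        ≡⟨ ℕ-interchange ∣ J ∣ _ _ _ ⟩
      (∣ J ∣ ℕ.+ ∣ K ∣) ℕ.+ (#⊇ J P ℕ.+ #⊇ K P)
        ≤⟨ ℕₚ.+-mono-≤ (ℕₚ.≤-reflexive (sym (∣∪∣+∣∩∣ J K))) supermodular ⟩
      (∣ J ∪ K ∣ ℕ.+ ∣ J ∩ K ∣) ℕ.+ (#⊇ (J ∪ K) P ℕ.+ #⊇ (J ∩ K) P)
        ≡⟨ ℕ-interchange ∣ J ∪ K ∣ _ _ _ ⟩
      (∣ J ∪ K ∣ ℕ.+ #⊇ (J ∪ K) P) ℕ.+ (∣ J ∩ K ∣ ℕ.+ #⊇ (J ∩ K) P)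
        ≤⟨ ℕₚ.+-monoˡ-≤ _ (ℕₚ.≤-trans (ℕₚ.+-monoʳ-≤ ∣ J ∪ K ∣ (ℕₚ.m≤n+m _ _)) (hall (J ∪ K) (∪-lub J⊆X K⊆X))) ⟩
      suc (length P) ℕ.+ (∣ J ∩ K ∣ ℕ.+ #⊇ (J ∩ K) P) ∎)
    where
    open ℕₚ.≤-Reasoning
    supermodular : #⊇ J P ℕ.+ #⊇ K P ℕ.≤ #⊇ (J ∪ K) P ℕ.+ #⊇ (J ∩ K) P
    supermodular = count-exchange (J ⊆?_) (K ⊆?_) ((J ∪ K) ⊆?_) ((J ∩ K) ⊆?_)
      (λ Z J⊆Z → inj₂ (λ x∈ → J⊆Z (p∩q⊆p J K x∈)))
      (λ Z K⊆Z → inj₂ (λ x∈ → K⊆Z (p∩q⊆q J K x∈)))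
      (λ Z J⊆Z K⊆Z → ∪-lub J⊆Z K⊆Z , (λ x∈ → J⊆Z (p∩q⊆p J K x∈))) P

  extend : Dec (∃ λ x → x ∈ J₀ × x ∉ Y) → IsPartialTransversal (complements (Y ∷ P)) X
  extend (no none) = ⊥-elim (deficient⊈Y J₀ (J₀⊆X , J₀-def) J₀⊆Y)
    where
    J₀⊆Y : J₀ ⊆ Y
    J₀⊆Y {x} x∈J₀ with x ∈? Y
    ... | yes x∈Y = x∈Y
    ... | no x∉Y = contradiction (x , x∈J₀ , x∉Y) none
  extend (yes (z , z∈J₀ , z∉Y)) = f , f∈ , f-inj
    where
    hall-z : Hall P (X - z)
    hall-z J J⊆ = ℕₚ.≮⇒≥ λ J-def →
      J₀-min (J₀ ∩ J)
        (p∩q⊆p J₀ J , z , z∈J₀ , λ z∈ → x∉X-x z X (J⊆ (p∩q⊆q J₀ J z∈)))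
        (deficient-∩ J₀ J (J₀⊆X , J₀-def) ((λ x∈ → -⊆ X z (J⊆ x∈)) , J-def))
    rest : IsPartialTransversal (complements P) (X - z)
    rest = Hall⇒transversal P (X - z) hall-z
    g = proj₁ rest
    f : Fin _ → Fin _
    f x with x Fin.≟ z
    ... | yes _ = zero
    ... | no _ = suc (g x)
    f∈ : ∀ x → x ∈ X → x ∈ complements (Y ∷ P) (f x)
    f∈ x x∈X with x Fin.≟ z
    ... | yes refl = x∉p⇒x∈∁p z∉Y
    ... | no x≢z = proj₁ (proj₂ rest) x (x∈p∧x≢y⇒x∈p-y x∈X x≢z)
    f-inj : ∀ x y → x ∈ X → y ∈ X → f x ≡ f y → x ≡ y
    f-inj x y x∈X y∈X eq with x Fin.≟ z | y Fin.≟ z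
    ... | yes x≡z | yes y≡z = trans x≡z (sym y≡z)
    ... | yes _ | no _ = contradiction eq λ ()
    ... | no _ | yes _ = contradiction eq λ ()
    ... | no x≢z | no y≢z =
      proj₂ (proj₂ rest) x y (x∈p∧x≢y⇒x∈p-y x∈X x≢z) (x∈p∧x≢y⇒x∈p-y y∈X y≢z) (Finₚ.suc-injective eq)

-- The matching takes values in ℕ so that removing the head of the family is
-- just a predecessor.
Misses : List (Subset n) → ℕ → Fin n → Set
Misses [] _ x = ⊥₀
Misses (Y ∷ Q) zero x = x ∉ Y
Misses (Y ∷ Q) (suc i) x = Misses Q i x

-- The elements of D occupy |D| different positions of Q, and the member at such a position misses
-- an element of D, so it is not among those containing D.
matching-bound : ∀ (Q : List (Subset n)) D (f : Fin n → ℕ) → (∀ x → x ∈ D → Misses Q (f x) x) →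
  (∀ x y → x ∈ D → y ∈ D → f x ≡ f y → x ≡ y) → ∣ D ∣ ℕ.+ #⊇ D Q ℕ.≤ length Q

matching-bound-tail : ∀ Y (Q : List (Subset n)) D (f : Fin n → ℕ) → (∀ x → x ∈ D → f x ≢ 0) →
  (∀ x → x ∈ D → Misses (Y ∷ Q) (f x) x) → (∀ x y → x ∈ D → y ∈ D → f x ≡ f y → x ≡ y) →
  ∣ D ∣ ℕ.+ #⊇ D Q ℕ.≤ length Q
matching-bound-tail Y Q D f f≢0 miss inj = matching-bound Q D (ℕ.pred ∘ f) miss′ inj′
  where
  miss′ : ∀ x → x ∈ D → Misses Q (ℕ.pred (f x)) x
  miss′ x x∈ with f x | f≢0 x x∈ | miss x x∈
  ... | zero | ≢0 | _ = contradiction refl ≢0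
  ... | suc i | _ | m = m
  inj′ : ∀ x y → x ∈ D → y ∈ D → ℕ.pred (f x) ≡ ℕ.pred (f y) → x ≡ y
  inj′ x y x∈ y∈ eq with f x | f y | f≢0 x x∈ | f≢0 y y∈ | inj x y x∈ y∈
  ... | zero | _ | ≢0 | _ | _ = contradiction refl ≢0
  ... | suc _ | zero | _ | ≢0 | _ = contradiction refl ≢0
  ... | suc _ | suc _ | _ | _ | inj-xy = inj-xy (cong suc eq)

matching-bound {n} [] D f miss inj =
  ℕₚ.≤-reflexive (trans (ℕₚ.+-identityʳ ∣ D ∣) (trans (cong ∣_∣ (Empty-unique {p = D} λ (x , x∈) → miss x x∈)) (∣⊥∣≡0 n)))
matching-bound (Y ∷ Q) D f miss inj with Finₚ.any? (λ x → (x ∈? D) ×-dec (f x ℕ.≟ 0))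
... | yes (z , z∈D , fz≡0) = begin
    ∣ D ∣ ℕ.+ (indicator (D ⊆? Y) ℕ.+ #⊇ D Q) ≡⟨ cong (λ i → ∣ D ∣ ℕ.+ (i ℕ.+ #⊇ D Q)) (D⊈Y (D ⊆? Y)) ⟩
    ∣ D ∣ ℕ.+ #⊇ D Q                  ≤⟨ ℕₚ.+-mono-≤ (∣∣≤1+∣-∣ D z) (count-mono (D ⊆?_) ((D - z) ⊆?_) Q (λ _ D⊆ x∈ → D⊆ (-⊆ D z x∈))) ⟩
    suc (∣ D - z ∣ ℕ.+ #⊇ (D - z) Q)  ≤⟨ s≤s (matching-bound-tail Y Q (D - z) f f≢0 (λ x x∈ → miss x (-⊆ D z x∈))
                                           (λ x y x∈ y∈ → inj x y (-⊆ D z x∈) (-⊆ D z y∈))) ⟩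
    suc (length Q) ∎
  where
  open ℕₚ.≤-Reasoning
  D⊈Y : (d : Dec (D ⊆ Y)) → indicator d ≡ 0
  D⊈Y (no _) = refl
  D⊈Y (yes D⊆Y) = contradiction (D⊆Y z∈D) (subst (λ i → Misses (Y ∷ Q) i z) fz≡0 (miss z z∈D))
  f≢0 : ∀ x → x ∈ D - z → f x ≢ 0
  f≢0 x x∈ fx≡0 = x∉X-x z D (subst (_∈ D - z) (inj x z (-⊆ D z x∈) z∈D (trans fx≡0 (sym fz≡0))) x∈)
... | no none = begin
    ∣ D ∣ ℕ.+ (indicator (D ⊆? Y) ℕ.+ #⊇ D Q) ≤⟨ ℕₚ.+-monoʳ-≤ ∣ D ∣ (ℕₚ.+-monoˡ-≤ _ (indicator≤1 (D ⊆? Y))) ⟩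
    ∣ D ∣ ℕ.+ suc (#⊇ D Q)                    ≡⟨ ℕₚ.+-suc ∣ D ∣ _ ⟩
    suc (∣ D ∣ ℕ.+ #⊇ D Q)                    ≤⟨ s≤s (matching-bound-tail Y Q D f (λ x x∈ fx≡0 → none (x , x∈ , fx≡0)) miss inj) ⟩
    suc (length Q) ∎
  where open ℕₚ.≤-Reasoning

Misses-lookup : ∀ (Q : List (Subset n)) i x → x ∉ lookup Q i → Misses Q (Fin.toℕ i) x
Misses-lookup (Y ∷ Q) zero x x∉ = x∉
Misses-lookup (Y ∷ Q) (suc i) x x∉ = Misses-lookup Q i x x∉

-- The extra member ⊤ contains every J, so it adds one to both sides of `matching-bound` and
-- cancels.
transversal⇒Hall : ∀ (P : List (Subset n)) X → IsPartialTransversal (complements P) X → Hall P X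
transversal⇒Hall P X (f , f∈ , f-inj) J J⊆X = ℕₚ.≤-pred (begin
    suc (∣ J ∣ ℕ.+ #⊇ J P)       ≡⟨ ℕₚ.+-suc ∣ J ∣ _ ⟨
    ∣ J ∣ ℕ.+ suc (#⊇ J P)       ≡⟨ cong (∣ J ∣ ℕ.+_) (#⊇-∷ʳ P) ⟨
    ∣ J ∣ ℕ.+ #⊇ J (P ∷ʳ ⊤)      ≤⟨ matching-bound (P ∷ʳ ⊤) J (Fin.toℕ ∘ f)
                                      (λ x x∈ → Misses-lookup (P ∷ʳ ⊤) (f x) x (x∈∁p⇒x∉p (f∈ x (J⊆X x∈))))
                                      (λ x y x∈ y∈ eq → f-inj x y (J⊆X x∈) (J⊆X y∈) (Finₚ.toℕ-injective eq)) ⟩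
    length (P ∷ʳ ⊤)              ≡⟨ trans (length-++ P) (ℕₚ.+-comm (length P) 1) ⟩
    suc (length P) ∎)
  where
  open ℕₚ.≤-Reasoning
  #⊇-∷ʳ : ∀ P → #⊇ J (P ∷ʳ ⊤) ≡ suc (#⊇ J P)
  #⊇-∷ʳ [] with J ⊆? ⊤
  ... | yes _ = refl
  ... | no J⊈⊤ = ⊥-elim (J⊈⊤ ⊆⊤)
  #⊇-∷ʳ (Y ∷ P) = trans (cong (indicator (J ⊆? Y) ℕ.+_) (#⊇-∷ʳ P)) (ℕₚ.+-suc _ _)

-- Closure and cyclic flats

module _ (M : Matroid n) where
  open Matroid M

  r-⊥ : r ⊥ ≡ 0
  r-⊥ = ℕₚ.n≤0⇒n≡0 (subst (r ⊥ ℕ.≤_) (∣⊥∣≡0 n) (r-bound ⊥))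

  r-submod-⊆ : ∀ {U I} X Y → U ⊆ X ∪ Y → I ⊆ X → I ⊆ Y → r U ℕ.+ r I ℕ.≤ r X ℕ.+ r Y
  r-submod-⊆ X Y U⊆ I⊆X I⊆Y = ℕₚ.≤-trans
    (ℕₚ.+-mono-≤ (r-mono _ _ U⊆) (r-mono _ _ (∩-glb I⊆X I⊆Y))) (r-submod X Y)

  -- Submodularity for B and A ∪ W, both of which contain A. It lets a set inside a union be
  -- replaced by its closure, or by itself less an element that is no isthmus.
  r-absorb : ∀ {A B} W → A ⊆ B → r B ℕ.≤ r A → r (B ∪ W) ℕ.≤ r (A ∪ W)
  r-absorb {A} {B} W A⊆B rB≤rA = ℕₚ.+-cancelʳ-≤ (r A) _ _ (begin
    r (B ∪ W) ℕ.+ r A ≤⟨ r-submod-⊆ B (A ∪ W) (∪-mono id (q⊆p∪q A W)) A⊆B (p⊆p∪q W) ⟩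
    r B ℕ.+ r (A ∪ W) ≤⟨ ℕₚ.+-monoˡ-≤ _ rB≤rA ⟩
    r A ℕ.+ r (A ∪ W) ≡⟨ ℕₚ.+-comm (r A) _ ⟩
    r (A ∪ W) ℕ.+ r A ∎)
    where open ℕₚ.≤-Reasoning

  ∈cl⇒ : ∀ {X e} → e ∈ cl M X → r (X ∪ ⁅ e ⁆) ℕ.≤ r X
  ∈cl⇒ {X} {e} e∈ with r (X ∪ ⁅ e ⁆) ℕ.≟ r X
                     | trans (sym (lookup∘tabulate (λ e → ⌊ r (X ∪ ⁅ e ⁆) ℕ.≟ r X ⌋) e)) ([]=⇒lookup e∈)
  ... | yes eq | _ = ℕₚ.≤-reflexive eq

  ⇒∈cl : ∀ {X e} → r (X ∪ ⁅ e ⁆) ℕ.≤ r X → e ∈ cl M X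
  ⇒∈cl {X} {e} le with r (X ∪ ⁅ e ⁆) ℕ.≟ r X | lookup∘tabulate (λ e → ⌊ r (X ∪ ⁅ e ⁆) ℕ.≟ r X ⌋) e
  ... | yes _ | eq = lookup⇒[]= e (cl M X) eq
  ... | no neq | _ = contradiction (ℕₚ.≤-antisym le (r-mono _ _ (p⊆p∪q ⁅ e ⁆))) neq

  ⊆cl : ∀ X → X ⊆ cl M X
  ⊆cl X e∈X = ⇒∈cl (r-mono _ _ (∪-lub id (⁅⁆⊆ e∈X)))

  -- Membership in `cl` is tested one element at a time. The elements of Y are peeled off in turn,
  -- and submodularity over the common part X keeps the rank at r X.
  r-span : ∀ X Y → Y ⊆ cl M X → r (X ∪ Y) ℕ.≤ r X
  r-span X Y = go Y (⊂-wellFounded Y)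
    where
    go : ∀ Y → Acc _⊂_ Y → Y ⊆ cl M X → r (X ∪ Y) ℕ.≤ r X
    go Y (acc rec) Y⊆ with nonempty? Y
    ... | no empty = r-mono _ _ (∪-lub id (λ x∈Y → contradiction (_ , x∈Y) empty))
    ... | yes (e , e∈Y) = ℕₚ.+-cancelʳ-≤ (r X) _ _ (begin
      r (X ∪ Y) ℕ.+ r X
        ≤⟨ r-submod-⊆ (X ∪ (Y - e)) (X ∪ ⁅ e ⁆)
             (∪-lub (λ x∈ → p⊆p∪q _ (p⊆p∪q _ x∈)) Y⊆′) (p⊆p∪q _) (p⊆p∪q _) ⟩
      r (X ∪ (Y - e)) ℕ.+ r (X ∪ ⁅ e ⁆)
        ≤⟨ ℕₚ.+-mono-≤ (go (Y - e) (rec (x∈p⇒p-x⊂p e∈Y)) (λ x∈ → Y⊆ (-⊆ Y e x∈))) (∈cl⇒ (Y⊆ e∈Y)) ⟩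
      r X ℕ.+ r X ∎)
      where
      open ℕₚ.≤-Reasoning
      Y⊆′ : Y ⊆ (X ∪ (Y - e)) ∪ (X ∪ ⁅ e ⁆)
      Y⊆′ {x} x∈ with x Fin.≟ e
      ... | yes refl = q⊆p∪q (X ∪ (Y - e)) _ (q⊆p∪q X _ (x∈⁅x⁆ e))
      ... | no x≢e = p⊆p∪q (X ∪ ⁅ e ⁆) (q⊆p∪q X _ (x∈p∧x≢y⇒x∈p-y x∈ x≢e))

  r-cl : ∀ X → r (cl M X) ℕ.≤ r X
  r-cl X = ℕₚ.≤-trans (r-mono _ _ (q⊆p∪q X _)) (r-span X (cl M X) id)

  r-cl≡ : ∀ X → r (cl M X) ≡ r X
  r-cl≡ X = ℕₚ.≤-antisym (r-cl X) (r-mono _ _ (⊆cl X))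

  cl-isFlat : ∀ X → IsFlat M (cl M X)
  cl-isFlat X = ⊆-antisym
    (λ {e} e∈ → ⇒∈cl (ℕₚ.≤-trans (r-mono _ _ (∪-mono (⊆cl X) id)) (ℕₚ.≤-trans (∈cl⇒ e∈) (r-cl X))))
    (⊆cl (cl M X))

  cl⊆flat : ∀ {X F} → IsFlat M F → X ⊆ F → cl M X ⊆ F
  cl⊆flat {X} {F} flat X⊆F {e} e∈ = subst (e ∈_) flat (⇒∈cl (begin
    r (F ∪ ⁅ e ⁆)       ≤⟨ r-mono _ _ (∪-lub (q⊆p∪q (X ∪ ⁅ e ⁆) F) (λ x∈ → p⊆p∪q F (q⊆p∪q X _ x∈))) ⟩
    r ((X ∪ ⁅ e ⁆) ∪ F) ≤⟨ r-absorb F (p⊆p∪q _) (∈cl⇒ e∈) ⟩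
    r (X ∪ F)           ≤⟨ r-mono _ _ (∪-lub X⊆F id) ⟩
    r F ∎))
    where open ℕₚ.≤-Reasoning

  cyclic⇒r≤ : ∀ {X} → IsCyclic M X → ∀ e → r X ℕ.≤ r (X - e)
  cyclic⇒r≤ {X} cyc e with e ∈? X
  ... | yes e∈X = ℕₚ.≮⇒≥ (λ < → cyc e (e∈X , <))
  ... | no e∉X = r-mono _ _ (⊆- id e∉X)

  r≤⇒cyclic : ∀ {X} → (∀ e → e ∈ X → r X ℕ.≤ r (X - e)) → IsCyclic M X
  r≤⇒cyclic h e (e∈X , <) = ℕₚ.<⇒≱ < (h e e∈X)

  cl-cyclic : ∀ {X} → IsCyclic M X → IsCyclicFlat M (cl M X)
  cl-cyclic {X} cyc = cl-isFlat X , r≤⇒cyclic (λ e _ →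
    ℕₚ.≤-trans (r-cl X) (ℕₚ.≤-trans (cyclic⇒r≤ cyc e) (r-mono _ _ (-mono e (⊆cl X)))))

  ∪-cyclic : ∀ {X Y} → IsCyclic M X → IsCyclic M Y → IsCyclic M (X ∪ Y)
  ∪-cyclic {X} {Y} cX cY = r≤⇒cyclic λ e _ → begin
    r (X ∪ Y)             ≤⟨ r-absorb Y (-⊆ X e) (cyclic⇒r≤ cX e) ⟩
    r ((X - e) ∪ Y)       ≤⟨ r-mono _ _ (∪-lub (q⊆p∪q Y _) (p⊆p∪q _)) ⟩
    r (Y ∪ (X - e))       ≤⟨ r-absorb (X - e) (-⊆ Y e) (cyclic⇒r≤ cY e) ⟩
    r ((Y - e) ∪ (X - e)) ≤⟨ r-mono _ _ (∪-lub (-mono e (q⊆p∪q X Y)) (-mono e (p⊆p∪q Y))) ⟩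
    r (X ∪ Y - e) ∎
    where open ℕₚ.≤-Reasoning

  cyclicFlat? : Decidable (IsCyclicFlat M)
  cyclicFlat? X = ≡-dec Bool._≟_ (cl M X) X
    ×-dec Finₚ.all? (λ e → ¬? ((e ∈? X) ×-dec (r (X - e) ℕ.<? r X)))

  -- The nullity |X| - r X, compared additively to avoid truncated subtraction. Passing from X to Y
  -- raises the rank by at most |Y ─ X|.
  nullity-mono : ∀ {X Y} → X ⊆ Y → ∣ X ∣ ℕ.+ r Y ℕ.≤ ∣ Y ∣ ℕ.+ r X
  nullity-mono {X} {Y} X⊆Y = begin
    ∣ X ∣ ℕ.+ r Y                     ≤⟨ ℕₚ.+-monoʳ-≤ ∣ X ∣ (ℕₚ.m≤m+n _ _) ⟩
    ∣ X ∣ ℕ.+ (r Y ℕ.+ r ⊥)           ≤⟨ ℕₚ.+-monoʳ-≤ ∣ X ∣ (r-submod-⊆ X (Y ─ X) Y⊆ ⊥⊆ ⊥⊆) ⟩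
    ∣ X ∣ ℕ.+ (r X ℕ.+ r (Y ─ X))     ≤⟨ ℕₚ.+-monoʳ-≤ ∣ X ∣ (ℕₚ.+-monoʳ-≤ (r X) (r-bound _)) ⟩
    ∣ X ∣ ℕ.+ (r X ℕ.+ ∣ Y ─ X ∣)     ≡⟨ rotate ∣ X ∣ (r X) _ ⟩
    (∣ X ∣ ℕ.+ ∣ Y ─ X ∣) ℕ.+ r X     ≤⟨ ℕₚ.+-monoˡ-≤ (r X) (∣∣+∣─∣≤ X⊆Y) ⟩
    ∣ Y ∣ ℕ.+ r X ∎
    where
    open ℕₚ.≤-Reasoning
    rotate : ∀ a b c → a ℕ.+ (b ℕ.+ c) ≡ (a ℕ.+ c) ℕ.+ b
    rotate = solve-∀
    Y⊆ : Y ⊆ X ∪ (Y ─ X)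
    Y⊆ {x} x∈Y with x ∈? X
    ... | yes x∈X = p⊆p∪q _ x∈X
    ... | no x∉X = q⊆p∪q X _ (x∈p∧x∉q⇒x∈p─q x∈Y x∉X)

-- Presentations by complements of cyclic flats

-- Insertion: Y is dropped if it lies above a listed set, and otherwise replaces the listed sets
-- above it. A repeated member of the multiset P is thus listed only once.
minimals : ∀ (P : List (Subset n)) → ∃ λ B → (∀ {b} → b ∈ˡ B → b ∈ˡ P)
  × AllPairs (λ X Y → ¬ X ⊆ Y × ¬ Y ⊆ X) B × (∀ {Y} → Y ∈ˡ P → Any (_⊆ Y) B)
minimals [] = [] , id , [] , λ ()
minimals (Y ∷ P) with minimals P
... | B , B⊆P , incomparable , below with any? (_⊆? Y) B
...   | yes below-Y = B , there ∘ B⊆P , incomparable , λ { (here refl) → below-Y ; (there Z∈) → below Z∈ }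
...   | no none = Y ∷ filter (λ b → ¬? (Y ⊆? b)) B
    , (λ { (here eq) → here eq ; (there b∈) → there (B⊆P (proj₁ (∈-filter⁻ (λ b → ¬? (Y ⊆? b)) b∈))) })
    , All.tabulate (λ b∈ → let b∈B , Y⊈b = ∈-filter⁻ (λ b → ¬? (Y ⊆? b)) b∈ in Y⊈b , (λ b⊆Y → none (lose b∈B b⊆Y)))
        ∷ AllPairs.filter⁺ (λ b → ¬? (Y ⊆? b)) incomparable
    , λ { (here refl) → here id ; (there Z∈) → below′ (below Z∈) }
  where
  below′ : ∀ {Z} → Any (_⊆ Z) B → Any (_⊆ Z) (Y ∷ filter (λ b → ¬? (Y ⊆? b)) B)
  below′ b⊆Z with find b⊆Z
  ... | b , b∈B , b⊆ with Y ⊆? b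
  ...   | yes Y⊆b = here (λ x∈ → b⊆ (Y⊆b x∈))
  ...   | no Y⊈b = there (lose (∈-filter⁺ (λ b → ¬? (Y ⊆? b)) b∈B Y⊈b) b⊆)

⋂-glb : ∀ {X : Subset n} L → (∀ {a} → a ∈ˡ L → X ⊆ a) → X ⊆ foldr _∩_ ⊤ L
⋂-glb [] X⊆ = ⊆⊤
⋂-glb (a ∷ L) X⊆ = ∩-glb (X⊆ (here refl)) (⋂-glb L (X⊆ ∘ there))

-- In the subsets listed by increasing characteristic vector, a set precedes
-- its proper supersets.
allSubsets : ∀ n → List (Subset n)
allSubsets zero = [] ∷ []
allSubsets (suc n) = map (outside ∷_) (allSubsets n) ++ map (inside ∷_) (allSubsets n)

∈-allSubsets : ∀ (X : Subset n) → X ∈ˡ allSubsets n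
∈-allSubsets [] = here refl
∈-allSubsets (outside ∷ X) = ∈-++⁺ˡ (∈-map⁺ (outside ∷_) (∈-allSubsets X))
∈-allSubsets (inside ∷ X) = ∈-++⁺ʳ _ (∈-map⁺ (inside ∷_) (∈-allSubsets X))

allSubsets-ordered : ∀ n → AllPairs (λ X Y → ¬ Y ⊆ X) (allSubsets n)
allSubsets-ordered zero = [] ∷ []
allSubsets-ordered (suc n) = AllPairs.++⁺ (cons outside) (cons inside)
  (All.map⁺ (All.tabulate λ _ → All.map⁺ (All.tabulate λ _ in⊆out → in∉out (in⊆out Vec.here))))
  where
  in∉out : ∀ {X : Subset n} → zero ∉ outside ∷ X
  in∉out ()
  ∷-⊈ : ∀ s {X Y : Subset n} → ¬ Y ⊆ X → ¬ (s ∷ Y) ⊆ (s ∷ X)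
  ∷-⊈ s Y⊈X sY⊆sX = Y⊈X (drop-∷-⊆ sY⊆sX)
  cons : ∀ s → AllPairs (λ X Y → ¬ Y ⊆ X) (map (s ∷_) (allSubsets n))
  cons s = AllPairs.map⁺ (AllPairsᵇ.map (∷-⊈ s) (allSubsets-ordered n))

-- m plays the role of the intersection of the members up to x.
PrefixMeetBound : (Subset n → ℕ) → Subset n → Subset n → List (Subset n) → Set
PrefixMeetBound ρ m x [] = Unit
PrefixMeetBound ρ m x (y ∷ ys) = ρ (x ∪ y) ℕ.≤ ρ (m ∪ y) × PrefixMeetBound ρ (m ∩ y) y ys

ChainBounded : (Subset n → ℕ) → List (Subset n) → Set
ChainBounded ρ [] = Unit
ChainBounded ρ (x ∷ ys) = PrefixMeetBound ρ x x ys

record ChainOrdering (N : Matroid n) (B : List (Subset n)) : Set where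
  field
    ordering : List (Subset n)
    complete : ∀ {b} → b ∈ˡ B → b ∈ˡ ordering
    sound    : ∀ {b} → b ∈ˡ ordering → b ∈ˡ B
    bounded  : ChainBounded (Matroid.r N) ordering

module _ (N : Matroid n) where
  open Matroid N

  -- Once P has r ⊤ members, this says that exactly r X of their complements meet X.
  Exact : List (Subset n) → Subset n → Set
  Exact P X = #⊇ X P ℕ.+ r X ≡ r ⊤

  #∃⊆ : List (Subset n) → List (Subset n) → ℕ
  #∃⊆ L = count (λ Y → any? (_⊆? Y) L)

  -- A member of P containing s members of L contains both sides of at most
  -- s - 1 consecutive pairs of L.
  chain-count : ∀ P m x ys → (∀ {a} → a ∈ˡ x ∷ ys → Exact P a) →
    (∀ {a b} → a ∈ˡ x ∷ ys → b ∈ˡ x ∷ ys → Exact P (a ∪ b)) → PrefixMeetBound r m x ys →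
    #∃⊆ (x ∷ ys) P ℕ.+ r (m ∩ foldr _∩_ ⊤ ys) ℕ.≤ #⊇ x P ℕ.+ r m
  chain-count P m x [] ex ex∪ _ = ℕₚ.+-mono-≤
    (count-mono (λ Y → any? (_⊆? Y) (x ∷ [])) (x ⊆?_) P λ { _ (here x⊆Y) → x⊆Y })
    (r-mono _ _ (p∩q⊆p m ⊤))
  -- Exactness at x ∪ y and at y turns counts into ranks. What remains is the bound r (x ∪ y) ≤ r (m
  -- ∪ y), followed by submodularity for m and y.
  chain-count P m x (y ∷ ys) ex ex∪ (le , bound) = ℕₚ.+-cancelʳ-≤ (r ⊤) _ _ (begin
    (n∃ ℕ.+ rI) ℕ.+ r ⊤                               ≡⟨ cong ((n∃ ℕ.+ rI) ℕ.+_) (ex∪ (here refl) (there (here refl))) ⟨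
    (n∃ ℕ.+ rI) ℕ.+ (#⊇ (x ∪ y) P ℕ.+ r (x ∪ y))      ≡⟨ ℕ-interchange n∃ rI _ _ ⟩
    (n∃ ℕ.+ #⊇ (x ∪ y) P) ℕ.+ (rI ℕ.+ r (x ∪ y))      ≤⟨ ℕₚ.+-monoˡ-≤ _ exchange ⟩
    (#⊇ x P ℕ.+ n∃′) ℕ.+ (rI ℕ.+ r (x ∪ y))           ≡⟨ shuffle₁ (#⊇ x P) n∃′ rI _ ⟩
    (n∃′ ℕ.+ rI) ℕ.+ (#⊇ x P ℕ.+ r (x ∪ y))           ≤⟨ ℕₚ.+-monoˡ-≤ _ tail ⟩
    (#⊇ y P ℕ.+ r (m ∩ y)) ℕ.+ (#⊇ x P ℕ.+ r (x ∪ y)) ≤⟨ ℕₚ.+-monoʳ-≤ (#⊇ y P ℕ.+ r (m ∩ y)) (ℕₚ.+-monoʳ-≤ (#⊇ x P) le) ⟩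
    (#⊇ y P ℕ.+ r (m ∩ y)) ℕ.+ (#⊇ x P ℕ.+ r (m ∪ y)) ≡⟨ shuffle₂ (#⊇ y P) (r (m ∩ y)) (#⊇ x P) (r (m ∪ y)) ⟩
    (#⊇ x P ℕ.+ #⊇ y P) ℕ.+ (r (m ∪ y) ℕ.+ r (m ∩ y)) ≤⟨ ℕₚ.+-monoʳ-≤ (#⊇ x P ℕ.+ #⊇ y P) (r-submod m y) ⟩
    (#⊇ x P ℕ.+ #⊇ y P) ℕ.+ (r m ℕ.+ r y)             ≡⟨ ℕ-interchange (#⊇ x P) _ _ _ ⟩
    (#⊇ x P ℕ.+ r m) ℕ.+ (#⊇ y P ℕ.+ r y)             ≡⟨ cong ((#⊇ x P ℕ.+ r m) ℕ.+_) (ex (there (here refl))) ⟩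
    (#⊇ x P ℕ.+ r m) ℕ.+ r ⊤ ∎)
    where
    open ℕₚ.≤-Reasoning
    n∃ n∃′ rI : ℕ
    n∃ = #∃⊆ (x ∷ y ∷ ys) P
    n∃′ = #∃⊆ (y ∷ ys) P
    rI = r (m ∩ (y ∩ foldr _∩_ ⊤ ys))
    shuffle₁ : ∀ a b c d → (a ℕ.+ b) ℕ.+ (c ℕ.+ d) ≡ (b ℕ.+ c) ℕ.+ (a ℕ.+ d)
    shuffle₁ = solve-∀
    shuffle₂ : ∀ a b c d → (a ℕ.+ b) ℕ.+ (c ℕ.+ d) ≡ (c ℕ.+ a) ℕ.+ (d ℕ.+ b)
    shuffle₂ = solve-∀
    exchange : n∃ ℕ.+ #⊇ (x ∪ y) P ℕ.≤ #⊇ x P ℕ.+ n∃′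
    exchange = count-exchange (λ Y → any? (_⊆? Y) (x ∷ y ∷ ys)) ((x ∪ y) ⊆?_) (x ⊆?_) (λ Y → any? (_⊆? Y) (y ∷ ys))
      (λ { Y (here x⊆Y) → inj₁ x⊆Y ; Y (there a) → inj₂ a })
      (λ Y x∪y⊆Y → inj₁ (λ e∈ → x∪y⊆Y (p⊆p∪q y e∈)))
      (λ Y _ x∪y⊆Y → (λ e∈ → x∪y⊆Y (p⊆p∪q y e∈)) , here (λ e∈ → x∪y⊆Y (q⊆p∪q x y e∈))) P
    tail : n∃′ ℕ.+ rI ℕ.≤ #⊇ y P ℕ.+ r (m ∩ y)
    tail = subst (λ I → n∃′ ℕ.+ r I ℕ.≤ #⊇ y P ℕ.+ r (m ∩ y)) (∩-assoc m y _)
      (chain-count P (m ∩ y) y ys (ex ∘ there) (λ a∈ b∈ → ex∪ (there a∈) (there b∈)) bound)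

  -- A flat contains X exactly when it contains the closure of X, and both have the same rank.
  Exact-cl⇒Exact : ∀ {P X} → (∀ {Y} → Y ∈ˡ P → IsCyclicFlat N Y) → Exact P (cl N X) → Exact P X
  Exact-cl⇒Exact {P} {X} flats exact = trans (cong₂ ℕ._+_ #≡ (sym (r-cl≡ N X))) exact
    where
    #≡ : #⊇ X P ≡ #⊇ (cl N X) P
    #≡ = ℕₚ.≤-antisym
      (count-mono (X ⊆?_) (cl N X ⊆?_) P (λ Y∈ X⊆Y → cl⊆flat N (proj₁ (flats Y∈)) X⊆Y))
      (count-mono (cl N X ⊆?_) (X ⊆?_) P (λ _ cl⊆Y e∈ → cl⊆Y (⊆cl N X e∈)))

  module _ (order : ∀ B → IsAntichain N B → ChainOrdering N B) where

    -- As X is not a member of P, the minimal members containing X contain it properly. Hence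
    -- exactness is known at each of them, and at their pairwise unions because the closures of
    -- these are cyclic flats above X.
    exact-above⇒bound : ∀ P X → (∀ {Y} → Y ∈ˡ P → IsCyclicFlat N Y) → (∀ {Y} → Y ∈ˡ P → Y ≢ X) →
      (∀ F → IsCyclicFlat N F → X ⊂ F → Exact P F) → #⊇ X P ℕ.+ r X ℕ.≤ r ⊤
    exact-above⇒bound P X flats P≢X exact with minimals (filter (X ⊆?_) P)
    ... | B , B⊆ , incomparable , below = finish (ordering O) (complete O) (sound O) (bounded O)
      where
      open ChainOrdering
      B-flat : ∀ {b} → b ∈ˡ B → IsCyclicFlat N b
      B-flat b∈ = flats (proj₁ (∈-filter⁻ (X ⊆?_) (B⊆ b∈)))
      X⊂B : ∀ {b} → b ∈ˡ B → X ⊂ b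
      X⊂B b∈ = let b∈P , X⊆b = ∈-filter⁻ (X ⊆?_) (B⊆ b∈) in ⊆∧≢⇒⊂ X⊆b (λ eq → P≢X b∈P (sym eq))
      O : ChainOrdering N B
      O = order B (All.tabulate B-flat , incomparable)
      finish : ∀ L → (∀ {b} → b ∈ˡ B → b ∈ˡ L) → (∀ {b} → b ∈ˡ L → b ∈ˡ B) → ChainBounded r L →
        #⊇ X P ℕ.+ r X ℕ.≤ r ⊤
      finish L B⊆L L⊆B chain = ℕₚ.≤-trans (ℕₚ.+-monoˡ-≤ (r X) #⊇≤#∃⊆) (bound L L⊆B chain)
        where
        #⊇≤#∃⊆ : #⊇ X P ℕ.≤ #∃⊆ L P
        #⊇≤#∃⊆ = count-mono (X ⊆?_) (λ Y → any? (_⊆? Y) L) P λ Y∈P X⊆Y →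
          let b , b∈B , b⊆Y = find (below (∈-filter⁺ (X ⊆?_) Y∈P X⊆Y)) in lose (B⊆L b∈B) b⊆Y
        bound : ∀ L → (∀ {b} → b ∈ˡ L → b ∈ˡ B) → ChainBounded r L → #∃⊆ L P ℕ.+ r X ℕ.≤ r ⊤
        bound [] _ _ = ℕₚ.≤-trans
          (ℕₚ.+-monoˡ-≤ (r X) (ℕₚ.≤-reflexive (count-none P))) (r-mono _ _ ⊆⊤)
          where
          count-none : ∀ P → #∃⊆ [] P ≡ 0
          count-none [] = refl
          count-none (_ ∷ P) = count-none P
        bound (x ∷ ys) L⊆B chain = begin
          #∃⊆ (x ∷ ys) P ℕ.+ r X                        ≤⟨ ℕₚ.+-monoʳ-≤ (#∃⊆ (x ∷ ys) P) (r-mono _ _ X⊆⋂) ⟩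
          #∃⊆ (x ∷ ys) P ℕ.+ r (x ∩ foldr _∩_ ⊤ ys)     ≤⟨ chain-count P x x ys exact₁ exact₂ chain ⟩
          #⊇ x P ℕ.+ r x                                ≡⟨ exact₁ (here refl) ⟩
          r ⊤ ∎
          where
          open ℕₚ.≤-Reasoning
          X⊆⋂ : X ⊆ foldr _∩_ ⊤ (x ∷ ys)
          X⊆⋂ = ⋂-glb (x ∷ ys) (λ a∈ → proj₁ (X⊂B (L⊆B a∈)))
          exact₁ : ∀ {a} → a ∈ˡ x ∷ ys → Exact P a
          exact₁ a∈ = exact _ (B-flat (L⊆B a∈)) (X⊂B (L⊆B a∈))
          exact₂ : ∀ {a b} → a ∈ˡ x ∷ ys → b ∈ˡ x ∷ ys → Exact P (a ∪ b)
          exact₂ {a} {b} a∈ b∈ = Exact-cl⇒Exact flats (exact (cl N (a ∪ b))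
            (cl-cyclic N (∪-cyclic N (proj₂ (B-flat (L⊆B a∈))) (proj₂ (B-flat (L⊆B b∈)))))
            (⊂-⊆-trans (X⊂B (L⊆B a∈)) (λ e∈ → ⊆cl N (a ∪ b) (p⊆p∪q b e∈))))

    -- Taking the members of P from l guarantees that the next set to be treated is not yet in P.
    Presents : List (Subset n) → List (Subset n) → Set
    Presents l P = (∀ {Y} → Y ∈ˡ P → IsCyclicFlat N Y × Y ∈ˡ l) × (∀ {F} → F ∈ˡ l → IsCyclicFlat N F → Exact P F)

    upper-tail : ∀ {X : Subset n} {l} → All (λ Y → ¬ Y ⊆ X) l → (∀ {Y Z} → Y ∈ˡ X ∷ l → Y ⊆ Z → Z ∈ˡ X ∷ l) →
      ∀ {Y Z} → Y ∈ˡ l → Y ⊆ Z → Z ∈ˡ l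
    upper-tail X⊉l upper Y∈ Y⊆Z with upper (there Y∈) Y⊆Z
    ... | here refl = ⊥-elim (All.lookup X⊉l Y∈ Y⊆Z)
    ... | there Z∈ = Z∈

    -- The recursion treats the tail first, hence supersets before subsets. No set in the tail lies
    -- inside X, so adding copies of X preserves exactness there.
    present : ∀ l → AllPairs (λ X Y → ¬ Y ⊆ X) l → (∀ {X Y} → X ∈ˡ l → X ⊆ Y → Y ∈ˡ l) → ∃ (Presents l)
    present [] _ _ = [] , (λ ()) , λ ()
    present (X ∷ l) (X⊉l ∷ ordered) upper with present l ordered (upper-tail X⊉l upper)
    ... | P , flats , exact with cyclicFlat? N X
    ...   | no ¬flat = P , (λ Y∈ → proj₁ (flats Y∈) , there (proj₂ (flats Y∈)))
          , λ { (here refl) flat → contradiction flat ¬flat ; (there F∈) → exact F∈ }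
    ...   | yes flat = replicate k X ++ P , flats′ , exact′
      where
      -- The number of copies that makes X exact; by `bound` the subtraction is not truncated.
      k = r ⊤ ∸ (#⊇ X P ℕ.+ r X)
      #⊇-++ : ∀ F k → #⊇ F (replicate k X ++ P) ≡ k ℕ.* indicator (F ⊆? X) ℕ.+ #⊇ F P
      #⊇-++ F zero = refl
      #⊇-++ F (suc k) = trans (cong (indicator (F ⊆? X) ℕ.+_) (#⊇-++ F k)) (sym (ℕₚ.+-assoc (indicator (F ⊆? X)) _ _))
      flats′ : ∀ {Y} → Y ∈ˡ replicate k X ++ P → IsCyclicFlat N Y × Y ∈ˡ X ∷ l
      flats′ Y∈ with ∈-++⁻ (replicate k X) Y∈
      ... | inj₁ Y∈rep = subst (λ Y → IsCyclicFlat N Y × Y ∈ˡ X ∷ l) (sym (All.lookup {P = _≡ X} (All.replicate⁺ k refl) Y∈rep)) (flat , here refl)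
      ... | inj₂ Y∈P = proj₁ (flats Y∈P) , there (proj₂ (flats Y∈P))
      bound : #⊇ X P ℕ.+ r X ℕ.≤ r ⊤
      bound = exact-above⇒bound P X (proj₁ ∘ flats)
        (λ Y∈ Y≡X → All.lookup X⊉l (proj₂ (flats Y∈)) (⊆-reflexive Y≡X))
        λ F F-flat X⊂F → exact (above X⊂F) F-flat
        where
        above : ∀ {F} → X ⊂ F → F ∈ˡ l
        above X⊂F with upper (here refl) (proj₁ X⊂F)
        ... | here refl = contradiction X⊂F (⊂-irref refl)
        ... | there F∈ = F∈
      exact′ : ∀ {F} → F ∈ˡ X ∷ l → IsCyclicFlat N F → Exact (replicate k X ++ P) F
      exact′ {F} (there F∈) F-flat = trans (cong (ℕ._+ r F) (trans (#⊇-++ F k) k*0)) (exact F∈ F-flat)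
        where
        k*0 : k ℕ.* indicator (F ⊆? X) ℕ.+ #⊇ F P ≡ #⊇ F P
        k*0 with F ⊆? X
        ... | yes F⊆X = ⊥-elim (All.lookup X⊉l F∈ F⊆X)
        ... | no _ = cong (ℕ._+ #⊇ F P) (ℕₚ.*-zeroʳ k)
      exact′ (here refl) _ = trans (cong (ℕ._+ r X) (trans (#⊇-++ X k) k*1))
        (trans (ℕₚ.+-assoc k _ _) (ℕₚ.m∸n+n≡m bound))
        where
        k*1 : k ℕ.* indicator (X ⊆? X) ℕ.+ #⊇ X P ≡ k ℕ.+ #⊇ X P
        k*1 with X ⊆? X
        ... | yes _ = cong (ℕ._+ #⊇ X P) (ℕₚ.*-identityʳ k)
        ... | no X⊈X = ⊥-elim (X⊈X id)

    chain-ordered⇒transversal : ∀ E → IsTransversal E r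
    chain-ordered⇒transversal E with present (allSubsets n) (allSubsets-ordered n) (λ _ _ → ∈-allSubsets _)
    ... | P , flats , exact = _ , (λ i → complements P i ∩ E) , (λ i → p∩q⊆q (complements P i) E)
        , λ X X⊆E → mk⇔ (to X X⊆E) (from X)
      where
      exact-cyclic : ∀ {X} → IsCyclic N X → Exact P X
      exact-cyclic cyc = Exact-cl⇒Exact (proj₁ ∘ flats) (exact (∈-allSubsets _) (cl-cyclic N cyc))
      -- The empty set is cyclic, has rank 0 and lies in every member, so exactness at its closure
      -- counts all of P.
      length≡ : length P ≡ r ⊤
      length≡ = trans (sym (trans (cong (#⊇ ⊥ P ℕ.+_) (r-⊥ N)) (trans (ℕₚ.+-identityʳ _) (#⊇⊥ P))))
        (exact-cyclic (λ e (e∈⊥ , _) → ∉⊥ e∈⊥))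
        where
        #⊇⊥ : ∀ P → #⊇ ⊥ P ≡ length P
        #⊇⊥ [] = refl
        #⊇⊥ (Y ∷ P) with ⊥ ⊆? Y
        ... | yes _ = cong suc (#⊇⊥ P)
        ... | no ⊥⊈Y = ⊥-elim (⊥⊈Y ⊥⊆)
      -- An X that is not a cyclic flat cannot be a member of P, so `exact-above⇒bound` applies to
      -- it.
      bound : ∀ X → #⊇ X P ℕ.+ r X ℕ.≤ r ⊤
      bound X with cyclicFlat? N X
      ... | yes flat = ℕₚ.≤-reflexive (exact (∈-allSubsets X) flat)
      ... | no ¬flat = exact-above⇒bound P X (proj₁ ∘ flats)
        (λ Y∈ Y≡X → ¬flat (subst (IsCyclicFlat N) Y≡X (proj₁ (flats Y∈))))
        (λ F F-flat _ → exact (∈-allSubsets F) F-flat)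
      to : ∀ X → X ⊆ E → r X ≡ ∣ X ∣ → IsPartialTransversal (λ i → complements P i ∩ E) X
      to X X⊆E ind =
        let f , f∈ , inj = Hall⇒transversal P X hall in f , (λ x x∈ → x∈p∩q⁺ (f∈ x x∈ , X⊆E x∈)) , inj
        where
        open ℕₚ.≤-Reasoning
        hall : Hall P X
        hall J J⊆X = begin
          -- X has nullity 0, hence so has its subset J, which gives |J| ≤ r J.
          ∣ J ∣ ℕ.+ #⊇ J P   ≤⟨ ℕₚ.+-monoˡ-≤ _ (ℕₚ.+-cancelʳ-≤ (r X) _ _ (ℕₚ.≤-trans (nullity-mono N J⊆X)
                                 (ℕₚ.≤-reflexive (trans (cong (ℕ._+ r J) (sym ind)) (ℕₚ.+-comm (r X) (r J)))))) ⟩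
          r J ℕ.+ #⊇ J P     ≡⟨ ℕₚ.+-comm (r J) _ ⟩
          #⊇ J P ℕ.+ r J     ≤⟨ bound J ⟩
          r ⊤                ≡⟨ length≡ ⟨
          length P ∎
      -- A minimal dependent subset D is cyclic, so exactly r D < |D| of the
      -- presenting sets meet it.
      from : ∀ X → IsPartialTransversal (λ i → complements P i ∩ E) X → r X ≡ ∣ X ∣
      from X (f , f∈ , inj) with r X ℕ.≟ ∣ X ∣
      ... | yes ind = ind
      ... | no dep with minimal-subset (λ Y → ¬? (r Y ℕ.≟ ∣ Y ∣)) X dep
      ...   | D , D⊆X , D-dep , D-min = contradiction (ℕₚ.≤-antisym (r-bound D) ∣D∣≤r) D-dep
        where
        open ℕₚ.≤-Reasoning
        D-cyclic : IsCyclic N D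
        D-cyclic = r≤⇒cyclic N λ e e∈D → ℕₚ.≤-pred (begin
          suc (r D)       ≤⟨ ℕₚ.≤∧≢⇒< (r-bound D) D-dep ⟩
          ∣ D ∣           ≤⟨ ∣∣≤1+∣-∣ D e ⟩
          suc ∣ D - e ∣   ≡⟨ cong suc (sym (decidable-stable (_ ℕ.≟ _) (D-min (D - e) (x∈p⇒p-x⊂p e∈D)))) ⟩
          suc (r (D - e)) ∎)
        ∣D∣≤r : ∣ D ∣ ℕ.≤ r D
        ∣D∣≤r = ℕₚ.+-cancelʳ-≤ (#⊇ D P) _ _ (begin
          ∣ D ∣ ℕ.+ #⊇ D P  ≤⟨ transversal⇒Hall P X (f , (λ x x∈ → p∩q⊆p _ E (f∈ x x∈)) , inj) D D⊆X ⟩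
          length P          ≡⟨ length≡ ⟩
          r ⊤               ≡⟨ exact-cyclic D-cyclic ⟨
          #⊇ D P ℕ.+ r D    ≡⟨ ℕₚ.+-comm (#⊇ D P) (r D) ⟩
          r D ℕ.+ #⊇ D P ∎)

-- Contractions

module _ (M : Matroid n) where
  open Matroid M

  contract : Subset n → Matroid n
  contract C = record
    { r = minorRank M C
    ; r-bound = λ X → ℕₚ.m≤n+o⇒m∸n≤o (r (X ∪ C)) (r C) (begin
        r (X ∪ C)             ≤⟨ ℕₚ.m≤m+n _ _ ⟩
        r (X ∪ C) ℕ.+ r ⊥     ≤⟨ r-submod-⊆ M X C id ⊥⊆ ⊥⊆ ⟩
        r X ℕ.+ r C           ≤⟨ ℕₚ.+-monoˡ-≤ (r C) (r-bound X) ⟩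
        ∣ X ∣ ℕ.+ r C         ≡⟨ ℕₚ.+-comm ∣ X ∣ (r C) ⟩
        r C ℕ.+ ∣ X ∣ ∎)
    ; r-mono = λ X Y X⊆Y → ℕₚ.∸-monoˡ-≤ (r C) (r-mono _ _ (∪-mono X⊆Y id))
    -- Adding r C twice to each side undoes the truncated subtractions.
    ; r-submod = λ X Y → ℕₚ.+-cancelʳ-≤ (r C ℕ.+ r C) _ _ (begin
        (minorRank M C (X ∪ Y) ℕ.+ minorRank M C (X ∩ Y)) ℕ.+ (r C ℕ.+ r C)
          ≡⟨ restore (X ∪ Y) (X ∩ Y) ⟩
        r ((X ∪ Y) ∪ C) ℕ.+ r ((X ∩ Y) ∪ C)
          ≤⟨ r-submod-⊆ M (X ∪ C) (Y ∪ C) (∪-lub (∪-mono (p⊆p∪q C) (p⊆p∪q C)) (λ e∈ → p⊆p∪q (Y ∪ C) (q⊆p∪q X C e∈)))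
               (∪-mono (p∩q⊆p X Y) id) (∪-mono (p∩q⊆q X Y) id) ⟩
        r (X ∪ C) ℕ.+ r (Y ∪ C)
          ≡⟨ restore X Y ⟨
        (minorRank M C X ℕ.+ minorRank M C Y) ℕ.+ (r C ℕ.+ r C) ∎)
    }
    where
    open ℕₚ.≤-Reasoning
    restore : ∀ X Y → (minorRank M C X ℕ.+ minorRank M C Y) ℕ.+ (r C ℕ.+ r C) ≡ r (X ∪ C) ℕ.+ r (Y ∪ C)
    restore X Y = trans (ℕ-interchange (minorRank M C X) _ _ _)
      (cong₂ ℕ._+_ (ℕₚ.m∸n+n≡m (r-mono _ _ (q⊆p∪q X C))) (ℕₚ.m∸n+n≡m (r-mono _ _ (q⊆p∪q Y C))))

  r≤⇐minorRank≤ : ∀ {C} X Y → minorRank M C X ℕ.≤ minorRank M C Y → r (X ∪ C) ℕ.≤ r (Y ∪ C)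
  r≤⇐minorRank≤ {C} X Y le = begin
    r (X ∪ C)                    ≡⟨ ℕₚ.m∸n+n≡m (r-mono _ _ (q⊆p∪q X C)) ⟨
    minorRank M C X ℕ.+ r C      ≤⟨ ℕₚ.+-monoˡ-≤ (r C) le ⟩
    minorRank M C Y ℕ.+ r C      ≡⟨ ℕₚ.m∸n+n≡m (r-mono _ _ (q⊆p∪q Y C)) ⟩
    r (Y ∪ C) ∎
    where open ℕₚ.≤-Reasoning

  -- The elements of C are loops of the contraction, and a flat contains all loops.
  contract-flat⇒C⊆ : ∀ {C b} → IsFlat (contract C) b → C ⊆ b
  contract-flat⇒C⊆ {C} {b} flat {e} e∈C = subst (e ∈_) flat (⇒∈cl (contract C)
    (ℕₚ.∸-monoˡ-≤ (r C) (r-mono _ _ (∪-lub (∪-mono id (⁅⁆⊆ e∈C)) (q⊆p∪q b C)))))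

  contract-flat⇒flat : ∀ {C b} → IsFlat (contract C) b → IsFlat M b
  contract-flat⇒flat {C} {b} flat = ⊆-antisym
    (λ {e} e∈ → subst (e ∈_) flat (⇒∈cl (contract C)
      (ℕₚ.∸-monoˡ-≤ (r C) (r-absorb M C (p⊆p∪q ⁅ e ⁆) (∈cl⇒ M e∈)))))
    (⊆cl M b)

  -- A minimal subset of b with the nullity of b: this is the union of the
  -- circuits in b.
  cyclicCore-spec : ∀ b → ∃ λ a → a ⊆ b × (∣ b ∣ ℕ.+ r a ℕ.≤ ∣ a ∣ ℕ.+ r b)
    × (∀ Z → Z ⊂ a → ¬ (∣ b ∣ ℕ.+ r Z ℕ.≤ ∣ Z ∣ ℕ.+ r b))
  cyclicCore-spec b = minimal-subset (λ Y → ∣ b ∣ ℕ.+ r Y ℕ.≤? ∣ Y ∣ ℕ.+ r b) b ℕₚ.≤-refl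

  cyclicCore : Subset n → Subset n
  cyclicCore b = proj₁ (cyclicCore-spec b)

  cyclicCore⊆ : ∀ b → cyclicCore b ⊆ b
  cyclicCore⊆ b = proj₁ (proj₂ (cyclicCore-spec b))

  -- Adding an element of `cl M a` outside a would raise the nullity above that of b. Removing an
  -- isthmus of a would keep the nullity, against minimality.
  cyclicCore-cyclicFlat : ∀ {b} → IsFlat M b → IsCyclicFlat M (cyclicCore b)
  cyclicCore-cyclicFlat {b} flat with cyclicCore-spec b
  ... | a , a⊆b , nullity , minimal = ⊆-antisym cl⊆ (⊆cl M a) , r≤⇒cyclic M cyclic
    where
    open ℕₚ.≤-Reasoning
    cl⊆ : cl M a ⊆ a
    cl⊆ {e} e∈ with e ∈? a
    ... | yes e∈a = e∈a
    ... | no e∉a = contradiction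
      (ℕₚ.+-cancelʳ-≤ (r b) _ _ (begin
        ∣ a ∪ ⁅ e ⁆ ∣ ℕ.+ r b ≤⟨ nullity-mono M (∪-lub a⊆b (⁅⁆⊆ (cl⊆flat M flat a⊆b e∈))) ⟩
        ∣ b ∣ ℕ.+ r (a ∪ ⁅ e ⁆) ≤⟨ ℕₚ.+-monoʳ-≤ ∣ b ∣ (∈cl⇒ M e∈) ⟩
        ∣ b ∣ ℕ.+ r a           ≤⟨ nullity ⟩
        ∣ a ∣ ℕ.+ r b ∎))
      (ℕₚ.<⇒≱ (p⊂q⇒∣p∣<∣q∣ (p⊆p∪q ⁅ e ⁆ , e , q⊆p∪q a _ (x∈⁅x⁆ e) , e∉a)))
    cyclic : ∀ e → e ∈ a → r a ℕ.≤ r (a - e)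
    cyclic e e∈a = ℕₚ.+-cancelˡ-≤ ∣ b ∣ _ _ (begin
      ∣ b ∣ ℕ.+ r a             ≤⟨ nullity ⟩
      ∣ a ∣ ℕ.+ r b             ≤⟨ ℕₚ.+-monoˡ-≤ (r b) (∣∣≤1+∣-∣ a e) ⟩
      suc (∣ a - e ∣ ℕ.+ r b)   ≤⟨ ℕₚ.≰⇒> (minimal (a - e) (x∈p⇒p-x⊂p e∈a)) ⟩
      ∣ b ∣ ℕ.+ r (a - e) ∎)

  -- If e were no isthmus, b - e would have smaller nullity than b although it contains the core,
  -- which has the full nullity of b.
  ∉cyclicCore⇒isthmus : ∀ {b e} → e ∈ b → e ∉ cyclicCore b → r (b - e) ℕ.< r b
  ∉cyclicCore⇒isthmus {b} {e} e∈b e∉a with cyclicCore-spec b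
  ... | a , a⊆b , nullity , _ = ℕₚ.≰⇒> λ rb≤ → ℕₚ.<⇒≱ (x∈p⇒∣p-x∣<∣p∣ e∈b)
    (ℕₚ.+-cancelʳ-≤ (r a ℕ.+ r b) _ _ (begin
      ∣ b ∣ ℕ.+ (r a ℕ.+ r b)         ≡⟨ ℕₚ.+-assoc ∣ b ∣ _ _ ⟨
      (∣ b ∣ ℕ.+ r a) ℕ.+ r b         ≤⟨ ℕₚ.+-mono-≤ nullity rb≤ ⟩
      (∣ a ∣ ℕ.+ r b) ℕ.+ r (b - e)   ≡⟨ shuffle₁ ∣ a ∣ _ _ ⟩
      (∣ a ∣ ℕ.+ r (b - e)) ℕ.+ r b   ≤⟨ ℕₚ.+-monoˡ-≤ (r b) (nullity-mono M (⊆- a⊆b e∉a)) ⟩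
      (∣ b - e ∣ ℕ.+ r a) ℕ.+ r b     ≡⟨ ℕₚ.+-assoc ∣ b - e ∣ _ _ ⟩
      ∣ b - e ∣ ℕ.+ (r a ℕ.+ r b) ∎))
    where
    open ℕₚ.≤-Reasoning
    shuffle₁ : ∀ a b c → (a ℕ.+ b) ℕ.+ c ≡ (a ℕ.+ c) ℕ.+ b
    shuffle₁ = solve-∀

  -- An element of b outside the core is an isthmus of b in M. If it is also outside C, it remains
  -- an isthmus after contracting C, since C lies in b.
  cyclicCore∪C : ∀ {C b} → IsCyclicFlat (contract C) b → cyclicCore b ∪ C ≡ b
  cyclicCore∪C {C} {b} (flat , cyc) = ⊆-antisym (∪-lub (cyclicCore⊆ b) C⊆b) b⊆
    where
    C⊆b : C ⊆ b
    C⊆b = contract-flat⇒C⊆ flat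
    b⊆ : b ⊆ cyclicCore b ∪ C
    b⊆ {e} e∈b with e ∈? cyclicCore b | e ∈? C
    ... | yes e∈a | _ = p⊆p∪q C e∈a
    ... | no _ | yes e∈C = q⊆p∪q (cyclicCore b) C e∈C
    ... | no e∉a | no e∉C = contradiction (begin
        r b             ≤⟨ r-mono _ _ (p⊆p∪q C) ⟩
        r (b ∪ C)       ≤⟨ r≤⇐minorRank≤ b (b - e) (cyclic⇒r≤ (contract C) cyc e) ⟩
        r ((b - e) ∪ C) ≤⟨ r-mono _ _ (∪-lub id (⊆- C⊆b e∉C)) ⟩
        r (b - e) ∎) (ℕₚ.<⇒≱ (∉cyclicCore⇒isthmus e∈b e∉a))
      where open ℕₚ.≤-Reasoning

  -- Each b is recovered as its core together with C, so comparable cores would come from comparable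
  -- flats.
  cyclicCores-antichain : ∀ {C} B → IsAntichain (contract C) B → IsAntichain M (map cyclicCore B)
  cyclicCores-antichain [] _ = [] , []
  cyclicCores-antichain {C} (b ∷ B) (b-flat ∷ flats , b-inc ∷ inc) with cyclicCores-antichain B (flats , inc)
  ... | flats′ , inc′ = cyclicCore-cyclicFlat (contract-flat⇒flat (proj₁ b-flat)) ∷ flats′
      , All.map⁺ (All.tabulate λ {c} c∈ →
          let b⊈c , c⊈b = All.lookup b-inc c∈ ; c-flat = All.lookup flats c∈
          in (λ sub → b⊈c (reflect b-flat c-flat sub)) , (λ sub → c⊈b (reflect c-flat b-flat sub))) ∷ inc′
    where
    reflect : ∀ {b c} → IsCyclicFlat (contract C) b → IsCyclicFlat (contract C) c → cyclicCore b ⊆ cyclicCore c → b ⊆ c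
    reflect {b} {c} b-flat c-flat sub = subst (_⊆ c) (cyclicCore∪C b-flat)
      (∪-lub (λ e∈ → cyclicCore⊆ c (sub e∈)) (contract-flat⇒C⊆ (proj₁ c-flat)))

-- MI-orderings

module _ (M : Matroid n) where
  open Matroid M

  private
    infixr 6 _∨_
    infixr 7 _∧_
    _∨_ _∧_ : Subset n → Subset n → Subset n
    _∨_ = _∨ᶻ_ M
    _∧_ = _∧ᶻ_ M

  ∧⊆∩ : ∀ A B → A ∧ B ⊆ A ∩ B
  ∧⊆∩ A B {e} e∈ with anySubset? (λ C → (C ⊆? (A ∩ B)) ×-dec (circuit? M C ×-dec (e ∈? C)))
      | trans (sym (lookup∘tabulate (λ e → ⌊ anySubset? (λ C → (C ⊆? (A ∩ B)) ×-dec (circuit? M C ×-dec (e ∈? C))) ⌋) e)) ([]=⇒lookup e∈)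
  ... | yes (C , C⊆ , _ , e∈C) | _ = C⊆ e∈C

  -- The accumulator loop of meetList also carries the arguments of meetList as
  -- parameters. It has no accessible name, so unification finds it (meetLoop).
  loop-irrelevant : (f : Subset n → List (Subset n) → Subset n → List (Subset n) → Subset n) →
    (∀ x zs w → f x zs w [] ≡ w) → (∀ x zs w y ys → f x zs w (y ∷ ys) ≡ f x zs (w ∧ y) ys) →
    ∀ x zs x′ zs′ w ys → f x zs w ys ≡ f x′ zs′ w ys
  loop-irrelevant f f-[] f-∷ x zs x′ zs′ w [] = trans (f-[] x zs w) (sym (f-[] x′ zs′ w))
  loop-irrelevant f f-[] f-∷ x zs x′ zs′ w (y ∷ ys) = trans (f-∷ x zs w y ys)
    (trans (loop-irrelevant f f-[] f-∷ x zs x′ zs′ (w ∧ y) ys) (sym (f-∷ x′ zs′ w y ys)))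

  mutual
    meetLoop : Subset n → List (Subset n) → Subset n → List (Subset n) → Subset n
    meetLoop = _

    meetList-∷∷ : ∀ x y ys → meetList M (x ∷ y ∷ ys) ≡ meetList M ((x ∧ y) ∷ ys)
    -- After this abstraction the loop on the left is applied to distinct variables, a pattern that
    -- determines `meetLoop`.
    meetList-∷∷ x y ys with x ∧ y | y ∷ ys
    ... | w | zs = loop-irrelevant meetLoop (λ _ _ _ → refl) (λ _ _ _ _ _ → refl) x zs w ys w ys

  -- The meet condition as a recursion; m is the lattice meet of the terms up to and including x.
  MeetChain : Subset n → Subset n → List (Subset n) → Set
  MeetChain m x [] = Unit
  MeetChain m x (y ∷ ys) = (m ∨ y ≡ x ∨ y) × MeetChain (m ∧ y) y ys

  meetChain : ∀ m x ys →
    (∀ j → j ℕ.< length ys → meetList M (m ∷ take j ys) ∨ at M ys j ≡ at M (x ∷ ys) j ∨ at M ys j) →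
    MeetChain m x ys
  meetChain m x [] h = tt
  meetChain m x (y ∷ ys) h = h 0 (s≤s z≤n) , meetChain (m ∧ y) y ys λ j j< →
    trans (cong (_∨ at M ys j) (sym (meetList-∷∷ m y (take j ys)))) (h (suc j) (s≤s j<))

  MI⇒MeetChain : ∀ x ys → IsMIOrdering M (x ∷ ys) → MeetChain x x ys
  MI⇒MeetChain x ys (_ , meets) = meetChain x x ys h
    where
    h : ∀ j → j ℕ.< length ys → meetList M (x ∷ take j ys) ∨ at M ys j ≡ at M (x ∷ ys) j ∨ at M ys j
    -- The meet condition starts at 1 < k. For the first two terms the running meet is x itself.
    h zero _ = refl
    h (suc j) j< = meets (suc (suc j)) (s≤s (s≤s z≤n)) (s≤s j<)

  -- A join is the closure of a union, and taking closures inside a union with W does not change its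
  -- rank.
  r-∨ : ∀ {x y m} W → m ∨ y ≡ x ∨ y → r ((x ∪ y) ∪ W) ℕ.≤ r ((m ∪ y) ∪ W)
  r-∨ {x} {y} {m} W eq = begin
    r ((x ∪ y) ∪ W) ≤⟨ r-mono _ _ (∪-mono (⊆cl M (x ∪ y)) id) ⟩
    r ((x ∨ y) ∪ W) ≡⟨ cong (λ Z → r (Z ∪ W)) eq ⟨
    r ((m ∨ y) ∪ W) ≤⟨ r-absorb M W (⊆cl M (m ∪ y)) (r-cl M (m ∪ y)) ⟩
    r ((m ∪ y) ∪ W) ∎
    where open ℕₚ.≤-Reasoning

  -- The lattice meet m lies in the running intersection m′ of the sets with C adjoined, so the rank
  -- bound for m passes to m′.
  MeetChain⇒PrefixMeetBound : ∀ {C} m′ m x ys → m ⊆ m′ → MeetChain m x ys →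
    PrefixMeetBound (minorRank M C) m′ (x ∪ C) (map (_∪ C) ys)
  MeetChain⇒PrefixMeetBound m′ m x [] m⊆m′ _ = tt
  MeetChain⇒PrefixMeetBound {C} m′ m x (y ∷ ys) m⊆m′ (eq , chain) =
    ℕₚ.∸-monoˡ-≤ (r C) (begin
      r (((x ∪ C) ∪ (y ∪ C)) ∪ C) ≤⟨ r-mono _ _ (∪-lub (∪-lub (∪-mono (p⊆p∪q y) id) (∪-mono (q⊆p∪q x y) id)) (q⊆p∪q (x ∪ y) C)) ⟩
      r ((x ∪ y) ∪ C)             ≤⟨ r-∨ C eq ⟩
      r ((m ∪ y) ∪ C)             ≤⟨ r-mono _ _ (∪-mono (∪-mono m⊆m′ (p⊆p∪q C)) id) ⟩
      r ((m′ ∪ (y ∪ C)) ∪ C) ∎)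
    , MeetChain⇒PrefixMeetBound (m′ ∩ (y ∪ C)) (m ∧ y) y ys
        (λ e∈ → let e∈m , e∈y = x∈p∩q⁻ m y (∧⊆∩ m y e∈) in x∈p∩q⁺ (m⊆m′ e∈m , p⊆p∪q C e∈y)) chain
    where open ℕₚ.≤-Reasoning

  MILattice⇒contract-ordering : IsMILattice M → ∀ C B → IsAntichain (contract M C) B → ChainOrdering (contract M C) B
  MILattice⇒contract-ordering lattice C B antichain with lattice (map (cyclicCore M) B) (cyclicCores-antichain M B antichain)
  ... | L , L↭ , mi = record
    { ordering = map (_∪ C) L
    ; complete = λ {b} b∈ → subst (_∈ˡ map (_∪ C) L) (core∪C b∈)
        (∈-map⁺ (_∪ C) (∈-resp-↭ (↭-sym L↭) (∈-map⁺ (cyclicCore M) b∈)))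
    ; sound = sound
    ; bounded = bounded L mi
    }
    where
    core∪C : ∀ {b} → b ∈ˡ B → cyclicCore M b ∪ C ≡ b
    core∪C b∈ = cyclicCore∪C M (All.lookup (proj₁ antichain) b∈)
    sound : ∀ {b} → b ∈ˡ map (_∪ C) L → b ∈ˡ B
    sound b∈ with ∈-map⁻ (_∪ C) b∈
    ... | a , a∈ , refl with ∈-map⁻ (cyclicCore M) (∈-resp-↭ L↭ a∈)
    ...   | b , b∈B , refl = subst (_∈ˡ B) (sym (core∪C b∈B)) b∈B
    bounded : ∀ L → IsMIOrdering M L → ChainBounded (minorRank M C) (map (_∪ C) L)
    bounded [] _ = tt
    bounded (x ∷ ys) mi = MeetChain⇒PrefixMeetBound (x ∪ C) x x ys (p⊆p∪q C) (MI⇒MeetChain x ys mi)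

  MILattice⇒minor-transversal : IsMILattice M → ∀ C E → IsTransversal E (minorRank M C)
  MILattice⇒minor-transversal lattice C =
    chain-ordered⇒transversal (contract M C) (MILattice⇒contract-ordering lattice C)

  MILattice⇒transversal : IsMILattice M → ∀ E → IsTransversal E r
  MILattice⇒transversal lattice E with MILattice⇒minor-transversal lattice ⊥ E
  ... | k , A , A⊆ , A⇔ = k , A , A⊆ , λ X X⊆E → subst (λ ρ → (ρ ≡ ∣ X ∣) ⇔ IsPartialTransversal A X)
    (cong₂ _∸_ (cong r (∪-identityʳ X)) (r-⊥ M)) (A⇔ X X⊆E)

  -- Inclusion-exclusion

  -- Each branch decides whether the next set is taken; p sets, with union Z, have been taken so
  -- far. From 0 and ⊥ the empty family contributes -r ⊥ = 0.
  alternating : ℕ → Subset n → List (Subset n) → ℤ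
  alternating p Z [] = sgn M p ℤ.* + r Z
  alternating p Z (a ∷ as) = alternating (suc p) (Z ∪ a) as ℤ.+ alternating p Z as

  sum-sublists : ∀ p Z As (g : List (Subset n) → ℤ) →
    (∀ F → g F ≡ sgn M (p ℕ.+ length F) ℤ.* + r (Z ∪ foldr _∪_ ⊥ F)) →
    foldr (λ F s → g F ℤ.+ s) ℤ.0ℤ (sublists M As) ≡ alternating p Z As
  sum-sublists p Z [] g g≡ = trans (ℤₚ.+-identityʳ (g []))
    (trans (g≡ []) (cong₂ (λ q X → sgn M q ℤ.* + r X) (ℕₚ.+-identityʳ p) (∪-identityʳ Z)))
  sum-sublists p Z (a ∷ As) g g≡ = trans (split (sublists M As))
    (cong₂ ℤ._+_ (sum-sublists (suc p) (Z ∪ a) As (g ∘ (a ∷_)) ga≡) (sum-sublists p Z As g g≡))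
    where
    ga≡ : ∀ F → g (a ∷ F) ≡ sgn M (suc p ℕ.+ length F) ℤ.* + r ((Z ∪ a) ∪ foldr _∪_ ⊥ F)
    ga≡ F = trans (g≡ (a ∷ F))
      (cong₂ (λ q X → sgn M q ℤ.* + r X) (ℕₚ.+-suc p (length F)) (sym (∪-assoc Z a _)))
    split : ∀ l → foldr (λ F s → g F ℤ.+ s) ℤ.0ℤ (map (a ∷_) l ++ sublists M As)
      ≡ foldr (λ F s → g (a ∷ F) ℤ.+ s) ℤ.0ℤ l ℤ.+ foldr (λ F s → g F ℤ.+ s) ℤ.0ℤ (sublists M As)
    split [] = sym (ℤₚ.+-identityˡ _)
    split (F ∷ l) = trans (cong (λ k → g (a ∷ F) ℤ.+ k) (split l)) (sym (ℤₚ.+-assoc (g (a ∷ F)) _ _))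

  incExc≡alternating : ∀ As → incExc M As ≡ alternating 0 ⊥ As
  incExc≡alternating As = sum-sublists 0 ⊥ As (signedTerm M) term
    where
    term : ∀ F → signedTerm M F ≡ sgn M (length F) ℤ.* + r (⊥ ∪ foldr _∪_ ⊥ F)
    term [] = sym (cong (λ k → ℤ.-1ℤ ℤ.* + k) (trans (cong r (∪-identityˡ ⊥)) (r-⊥ M)))
    term (a ∷ F) = cong (λ X → sgn M (length (a ∷ F)) ℤ.* + r X) (sym (∪-identityˡ _))

  alternating-↭ : ∀ {L L′} → L ↭ L′ → ∀ p Z → alternating p Z L ≡ alternating p Z L′
  alternating-↭ _↭_.refl p Z = refl
  alternating-↭ (prep x π) p Z = cong₂ ℤ._+_ (alternating-↭ π (suc p) (Z ∪ x)) (alternating-↭ π p Z)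
  alternating-↭ (swap {xs} {ys} x y π) p Z = trans
    (ℤ-interchange (alternating (suc (suc p)) ((Z ∪ x) ∪ y) xs) (alternating (suc p) (Z ∪ x) xs) (alternating (suc p) (Z ∪ y) xs) _)
    (cong₂ ℤ._+_
    (cong₂ ℤ._+_ (trans (alternating-↭ π _ _) (cong (λ X → alternating (suc (suc p)) X ys) Zxy)) (alternating-↭ π _ _))
    (cong₂ ℤ._+_ (alternating-↭ π _ _) (alternating-↭ π _ _)))
    where
    Zxy : (Z ∪ x) ∪ y ≡ (Z ∪ y) ∪ x
    Zxy = trans (∪-assoc Z x y) (trans (cong (Z ∪_) (∪-comm x y)) (sym (∪-assoc Z y x)))
  alternating-↭ (_↭_.trans π₁ π₂) p Z = trans (alternating-↭ π₁ p Z) (alternating-↭ π₂ p Z)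

  sgn-suc : ∀ k → sgn M (suc k) ≡ ℤ.- sgn M k
  sgn-suc zero = refl
  sgn-suc (suc zero) = refl
  sgn-suc (suc (suc k)) = sgn-suc k

  -- Each subfamily of L occurs in both sums, with equal ranks and opposite signs.
  alternating-cancel : ∀ p Z Z′ L → (∀ W → r (Z ∪ W) ≡ r (Z′ ∪ W)) →
    alternating (suc p) Z L ℤ.+ alternating p Z′ L ≡ ℤ.0ℤ
  alternating-cancel p Z Z′ [] same = trans
    (cong₂ (λ s k → s ℤ.* + k ℤ.+ sgn M p ℤ.* + r Z′) (sgn-suc p)
      (trans (cong r (sym (∪-identityʳ Z))) (trans (same ⊥) (cong r (∪-identityʳ Z′)))))
    (neg (sgn M p) (+ r Z′))
    where
    neg : ∀ s k → (ℤ.- s) ℤ.* k ℤ.+ s ℤ.* k ≡ ℤ.0ℤ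
    neg = ℤ-solve-∀
  alternating-cancel p Z Z′ (a ∷ L) same = trans
    (ℤ-interchange (alternating (suc (suc p)) (Z ∪ a) L) (alternating (suc p) Z L) (alternating (suc p) (Z′ ∪ a) L) _)
    (cong₂ ℤ._+_
    (alternating-cancel (suc p) (Z ∪ a) (Z′ ∪ a) L λ W →
      trans (cong r (∪-assoc Z a W)) (trans (same (a ∪ W)) (cong r (sym (∪-assoc Z′ a W)))))
    (alternating-cancel p Z Z′ L same))

  -- Each later z contributes nothing: adding y to a subfamily containing x and z
  -- does not change the rank of the union.
  alternating-collapse : ∀ x y zs → (∀ {z} → z ∈ˡ zs → y ⊆ x ∨ z) →
    alternating 1 x (y ∷ zs) ℤ.+ + r (x ∪ y) ≡ + r x
  alternating-collapse x y [] _ = base (+ r (x ∪ y)) (+ r x)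
    where
    base : ∀ a b → (ℤ.-1ℤ ℤ.* a ℤ.+ ℤ.1ℤ ℤ.* b) ℤ.+ a ≡ b
    base = ℤ-solve-∀
  alternating-collapse x y (z ∷ zs) y⊆ = trans (cong (ℤ._+ + r (x ∪ y)) drop-z)
    (alternating-collapse x y zs (y⊆ ∘ there))
    where
    same : ∀ W → r (((x ∪ y) ∪ z) ∪ W) ≡ r ((x ∪ z) ∪ W)
    same W = ℕₚ.≤-antisym
      (ℕₚ.≤-trans
        (r-mono _ _ (∪-mono (∪-lub (∪-lub (λ e∈ → ⊆cl M (x ∪ z) (p⊆p∪q z e∈)) (y⊆ (here refl)))
          (λ e∈ → ⊆cl M (x ∪ z) (q⊆p∪q x z e∈))) id))
        (r-absorb M W (⊆cl M (x ∪ z)) (r-cl M (x ∪ z))))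
      (r-mono _ _ (∪-mono (∪-mono (p⊆p∪q y) id) id))
    drop-z : alternating 1 x (y ∷ z ∷ zs) ≡ alternating 1 x (y ∷ zs)
    drop-z = trans (ℤ-interchange (alternating 3 ((x ∪ y) ∪ z) zs) _ _ _)
      (trans (cong (ℤ._+ (alternating 2 (x ∪ y) zs ℤ.+ alternating 1 x zs))
        (alternating-cancel 2 ((x ∪ y) ∪ z) (x ∪ z) zs same)) (ℤₚ.+-identityˡ _))

  Interval : Subset n → List (Subset n) → Set
  Interval x [] = Unit
  Interval x (y ∷ ys) = (∀ {z} → z ∈ˡ ys → y ⊆ x ∨ z) × Interval y ys

  -- The join of all terms from x to z contains the second term y, and the join condition identifies
  -- it with x ∨ z.
  MI⇒Interval : ∀ x ys → (∀ i k → i ℕ.< k → k ℕ.< length (x ∷ ys) →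
      joinList M (take (suc k ∸ i) (drop i (x ∷ ys))) ≡ at M (x ∷ ys) i ∨ at M (x ∷ ys) k) → Interval x ys
  MI⇒Interval x [] joins = tt
  MI⇒Interval x (y ∷ ys) joins = y⊆ , MI⇒Interval y ys (λ i k i<k k< → joins (suc i) (suc k) (s≤s i<k) (s≤s k<))
    where
    head⊆ : ∀ zs → y ⊆ joinList M (y ∷ zs)
    head⊆ [] = id
    head⊆ (z ∷ zs) e∈ = ⊆cl M _ (p⊆p∪q (joinList M (z ∷ zs)) e∈)
    index : ∀ {z : Subset n} zs → z ∈ˡ zs → ∃ λ j → j ℕ.< length zs × at M zs j ≡ z
    index (_ ∷ zs) (here refl) = 0 , s≤s z≤n , refl
    index (_ ∷ zs) (there z∈) = let j , j< , eq = index zs z∈ in suc j , s≤s j< , eq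
    y⊆ : ∀ {z} → z ∈ˡ ys → y ⊆ x ∨ z
    y⊆ z∈ {e} e∈ with index ys z∈
    ... | j , j< , refl = subst (e ∈_) (joins 0 (suc (suc j)) (s≤s z≤n) (s≤s (s≤s j<)))
      (⊆cl M _ (q⊆p∪q x _ (head⊆ (take (suc j) ys) e∈)))

  -- By `alternating-collapse` the subfamilies containing x contribute r x - r (x ∪ y). The meet
  -- condition and submodularity for m′ and y match this, where m′ is the intersection and m the
  -- lattice meet of the terms so far.
  chain-alternating : ∀ m′ m x ys → m ⊆ m′ → MeetChain m x ys → Interval x ys →
    + r (m′ ∩ foldr _∩_ ⊤ ys) ℤ.+ + r x ≤ + r m′ ℤ.+ alternating 0 ⊥ (x ∷ ys)
  chain-alternating m′ m x [] _ _ _ = ℤₚ.+-mono-≤ (ℤ.+≤+ (r-mono _ _ (p∩q⊆p m′ ⊤))) (ℤₚ.≤-reflexive (sym (begin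
    ℤ.1ℤ ℤ.* + r (⊥ ∪ x) ℤ.+ ℤ.-1ℤ ℤ.* + r ⊥ ≡⟨ cong₂ (λ X k → ℤ.1ℤ ℤ.* + r X ℤ.+ ℤ.-1ℤ ℤ.* + k) (∪-identityˡ x) (r-⊥ M) ⟩
    ℤ.1ℤ ℤ.* + r x ℤ.+ ℤ.0ℤ                  ≡⟨ ℤₚ.+-identityʳ _ ⟩
    ℤ.1ℤ ℤ.* + r x                           ≡⟨ ℤₚ.*-identityˡ _ ⟩
    + r x ∎)))
    where open ≡-Reasoning
  chain-alternating m′ m x (y ∷ ys) m⊆m′ (eq , chain) (y⊆ , interval) = ℤ-+-cancelʳ-≤ (+ r y) (begin
    (+ rI ℤ.+ + r x) ℤ.+ + r y                    ≡⟨ cong (λ k → (+ rI ℤ.+ k) ℤ.+ + r y) (sym (alternating-collapse x y ys y⊆)) ⟩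
    (+ rI ℤ.+ (T ℤ.+ + r (x ∪ y))) ℤ.+ + r y      ≡⟨ shuffle₁ (+ rI) T _ _ ⟩
    (+ rI ℤ.+ + r y) ℤ.+ (T ℤ.+ + r (x ∪ y))      ≤⟨ ℤₚ.+-monoˡ-≤ _ tail ⟩
    (+ r (m′ ∩ y) ℤ.+ A) ℤ.+ (T ℤ.+ + r (x ∪ y))  ≡⟨ shuffle₂ (+ r (m′ ∩ y)) A T _ ⟩
    (+ r (x ∪ y) ℤ.+ + r (m′ ∩ y)) ℤ.+ (T ℤ.+ A)  ≤⟨ ℤₚ.+-monoˡ-≤ (T ℤ.+ A) (ℤ.+≤+ submodular) ⟩
    (+ r m′ ℤ.+ + r y) ℤ.+ (T ℤ.+ A)              ≡⟨ shuffle₃ (+ r m′) (+ r y) T A ⟩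
    (+ r m′ ℤ.+ (T ℤ.+ A)) ℤ.+ + r y              ≡⟨ cong (λ X → (+ r m′ ℤ.+ (alternating 1 X (y ∷ ys) ℤ.+ A)) ℤ.+ + r y) (sym (∪-identityˡ x)) ⟩
    (+ r m′ ℤ.+ alternating 0 ⊥ (x ∷ y ∷ ys)) ℤ.+ + r y ∎)
    where
    open ℤₚ.≤-Reasoning
    rI : ℕ
    rI = r (m′ ∩ (y ∩ foldr _∩_ ⊤ ys))
    T A : ℤ
    T = alternating 1 x (y ∷ ys)
    A = alternating 0 ⊥ (y ∷ ys)
    shuffle₁ : ∀ a b c d → (a ℤ.+ (b ℤ.+ c)) ℤ.+ d ≡ (a ℤ.+ d) ℤ.+ (b ℤ.+ c)
    shuffle₁ = ℤ-solve-∀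
    shuffle₂ : ∀ a b c d → (a ℤ.+ b) ℤ.+ (c ℤ.+ d) ≡ (d ℤ.+ a) ℤ.+ (c ℤ.+ b)
    shuffle₂ = ℤ-solve-∀
    shuffle₃ : ∀ a b c d → (a ℤ.+ b) ℤ.+ (c ℤ.+ d) ≡ (a ℤ.+ (c ℤ.+ d)) ℤ.+ b
    shuffle₃ = ℤ-solve-∀
    tail : + rI ℤ.+ + r y ≤ + r (m′ ∩ y) ℤ.+ A
    tail = subst (λ I → + r I ℤ.+ + r y ≤ + r (m′ ∩ y) ℤ.+ A) (∩-assoc m′ y _)
      (chain-alternating (m′ ∩ y) (m ∧ y) y ys
        (λ e∈ → let e∈m , e∈y = x∈p∩q⁻ m y (∧⊆∩ m y e∈) in x∈p∩q⁺ (m⊆m′ e∈m , e∈y)) chain interval)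
    submodular : r (x ∪ y) ℕ.+ r (m′ ∩ y) ℕ.≤ r m′ ℕ.+ r y
    submodular = ℕₚ.≤-trans (ℕₚ.+-monoˡ-≤ _ (ℕₚ.≤-trans (r-mono _ _ (p⊆p∪q ⊥))
        (ℕₚ.≤-trans (r-∨ ⊥ eq) (r-mono _ _ (∪-lub (∪-mono m⊆m′ id) ⊥⊆)))))
      (r-submod m′ y)

  MIOrderable⇒inequality : ∀ As → As ≢ [] → MIOrderable M As → + r (foldr _∩_ ⊤ As) ≤ incExc M As
  -- For an empty family the intersection is ⊤ while the sum is 0.
  MIOrderable⇒inequality As As≢[] ([] , L↭ , _) = contradiction (↭-empty-inv (↭-sym L↭)) As≢[]
  MIOrderable⇒inequality As _ (x ∷ ys , L↭ , mi) = begin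
    + r (foldr _∩_ ⊤ As)            ≤⟨ ℤ.+≤+ (r-mono _ _ ⋂⊆) ⟩
    + r (x ∩ foldr _∩_ ⊤ ys)        ≤⟨ ℤ-+-cancelʳ-≤ (+ r x) (ℤₚ.≤-trans
                                         (chain-alternating x x x ys id (MI⇒MeetChain x ys mi) (MI⇒Interval x ys (proj₁ mi)))
                                         (ℤₚ.≤-reflexive (ℤₚ.+-comm (+ r x) (alternating 0 ⊥ (x ∷ ys))))) ⟩
    alternating 0 ⊥ (x ∷ ys)        ≡⟨ alternating-↭ L↭ 0 ⊥ ⟩
    alternating 0 ⊥ As              ≡⟨ incExc≡alternating As ⟨
    incExc M As ∎
    where
    open ℤₚ.≤-Reasoning
    ⋂-lb : ∀ {a : Subset n} L → a ∈ˡ L → foldr _∩_ ⊤ L ⊆ a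
    ⋂-lb (b ∷ L) (here refl) = p∩q⊆p b _
    ⋂-lb (b ∷ L) (there a∈) e∈ = ⋂-lb L a∈ (p∩q⊆q b _ e∈)
    ⋂⊆ : foldr _∩_ ⊤ As ⊆ foldr _∩_ ⊤ (x ∷ ys)
    ⋂⊆ = ⋂-glb (x ∷ ys) (λ a∈ → ⋂-lb As (∈-resp-↭ L↭ a∈))

theorem3p4 : ∀ {n} (M : Matroid n)
    → (∀ (As : List (Subset n)) → IsAntichain M As → As ≢ [] → MIOrderable M As
    → + Matroid.r M (foldr _∩_ ⊤ As) ≤ incExc M As)
    × (IsMILattice M
    → IsTransversal ⊤ (Matroid.r M)
    × (∀ (C D : Subset n) → Disjoint C D
    → IsTransversal (minorGround C D) (minorRank M C)))
theorem3p4 M = (λ As _ → MIOrderable⇒inequality M As)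
  , λ lattice → MILattice⇒transversal M lattice ⊤
    , λ C D _ → MILattice⇒minor-transversal M lattice C (minorGround C D)
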